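{- Let $v,w\in S_n$ with $v\le w$ and $w$ $k$-Grassmannian, and let $f=f_{v,w}=w^{ -1}\tau_{k,n}v\in\mathbf{B}_{k,n}$ (so $f=x_wv$). Let $\mathbf{x_w}=(s_{i_1},\dots,s_{i_l})$ be a reduced word for $x_w$ and $\mathbf w$ a reduced word for $w$; the concatenation $\mathbf{x_w}\mathbf w$ is a reduced word for $\tau_{P_w}$. Then for any $r$, prepending all of $\mathbf{x_w}$, i.e. $(v_1,\dots,v_m)\mapsto(s_{i_1},\dots,s_{i_l},v_1,\dots,v_m)$, gives a bijection $$\mathcal{D}^r_{v,\mathbf w}\xrightarrow{\ \sim\ }\mathcal{A}^r_{x_wv,\,\mathbf{x_w}\mathbf w}=\mathcal{A}^r_{f,\,\boldsymbol{\tau_{P_w}}},$$ which restricts to a bijection $\operatorname{Deo}^{\max}_f\to\operatorname{Deo}^{\max}_{f,P_w}$. Moreover $(P_w)_U=w([k])=\overleftarrow{I_1}(f)$.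
   Context: Let $n\ge2$, $0\le k\le n$. $\tilde S_n$ is the group of bijections $f:\mathbb{Z}\to\mathbb{Z}$ with $f(i+n)=f(i)+n$, with products read left to right, $(fg)(a)=g(f(a))$. $\tilde S_n^{(k)}$ is the subset with $\frac1n\sum_{i=1}^n(f(i)-i)=k$, and $\mathbf{B}_{k,n}\subset\tilde S_n^{(k)}$ the subset with $i\le f(i)\le i+n$ for all $i$. $\overline f\in S_n$ is $f$ modulo $n$, $c(\overline f)$ its number of cycles. Length: $\ell(f)=\#\{(a,b):1\le a\le n,\ b\in\mathbb{Z},\ a<b,\ f(a)>f(b)\}$. $s_i$ ($0\le i\le n-1$) exchanges $i+mn$ and $i+1+mn$ for all $m$ and fixes all other integers. $\Lambda(i)=i+1$. $S_n=\langle s_1,\dots,s_{n-1}\rangle\subset\tilde S_n$ via periodic extension; $\tilde S_n^{(0)}=\langle s_0,\dots,s_{n-1}\rangle$; $\le$ is Bruhat order. A reduced word for $f\in\tilde S_n^{(k)}$ is a sequence $(s_{i_1},\dots,s_{i_m})$ with $s_{i_1}\cdots s_{i_m}=\Lambda^{ -k}f$, $m=\ell(f)$ (for $w\in S_n$, the usual notion). A subword of a word $\mathbf g=(s_{i_1},\dots,s_{i_m})$ is $\mathbf u=(u_1,\dots,u_m)$ with $u_j\in\{s_{i_j},e\}$; write $\mathbf u_{(j)}=u_1\cdots u_j$. It is distinguished if $\mathbf u_{(j)}\le\mathbf u_{(j-1)}s_{i_j}$ for all $j$. For $f\in\tilde S_n^{(k)}$ it is an $f$-subword if $\mathbf u_{(m)}=\Lambda^{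 -k}f$; for $v\in S_n$ and a word $\mathbf w$ in $s_1,\dots,s_{n-1}$, it is a $v$-subword if $\mathbf u_{(m)}=v$. $\mathcal{D}^r_{v,\mathbf w}$ is the set of distinguished $v$-subwords of $\mathbf w$ with exactly $r$ entries equal to $e$; $\mathcal{A}^r_{f,\mathbf g}$ is the set of distinguished $f$-subwords of $\mathbf g$ with exactly $r$ entries equal to $e$. $w\in S_n$ is $k$-Grassmannian if $w(1)<\dots<w(k)$ and $w(k+1)<\dots<w(n)$. $\tau_{k,n}\in\tilde S_n^{(k)}$: $\tau_{k,n}(i)=i+n$ for $1\le i\le k$, $\tau_{k,n}(i)=i$ for $k+1\le i\le n$. $x_w:=w^{ -1}\tau_{k,n}$. $P_w$ is the lattice path from $(0,0)$ to $(n-k,k)$ (unit right/up steps) whose set of up-step indices is $(P_w)_U=w([k])$; $\tau_{P_w}(i)=i+n$ if $i\bmod n\in(P_w)_U$ and $\tau_{P_w}(i)=i$ otherwise; $\boldsymbol{\tau_{P_w}}=\mathbf{x_w}\mathbf w$. Under the correspondence of crossings with selected letters and elbows with entries $e$, $f$-Deograms are the distinguished $v$-subwords of $\mathbf w$ and $(f,P_w)$-affine Deograms are the distinguished $f$-subwords of $\boldsymbol{\tau_{P_w}}$; so the maximal ones are $\operatorname{Deo}^{\max}_f=\mathcal{D}^{r_0}_{v,\mathbf w}$ and $\operatorname{Deo}^{\max}_{f,P_w}=\mathcal{A}^{r_0}_{f,\boldsymbol{\tau_{P_w}}}$ with $r_0=n-c(\overline f)$. Finally $\overleftarrow{I_1}(f)=\{a: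 a<1,\ f(a)\ge1\}\bmod n$ (residues in $[n]$). -}

module Defs where

open import Data.Bool.Base using (Bool; true; false; if_then_else_)
open import Data.Empty using (⊥-elim)
open import Data.Fin.Base using (Fin; toℕ; fromℕ<)
import Data.Fin.Properties as Fin
open import Data.Fin.Subset using (Subset)
open import Data.Integer.Base using (ℤ; +_; -_; 1ℤ; _+_; _-_; _*_; _≤_; _<_; _%ℕ_; _/ℕ_; ∣_∣)
import Data.Integer.Properties as ℤ
open import Data.Integer.DivMod using (n%ℕd<d; a≡a%ℕn+[a/ℕn]*n)
open import Data.Integer.Divisibility.Signed using (_∣_; _∣?_; divides; ∣⇒∣ᵤ; ∣-refl; ∣m∣n⇒∣m+n; ∣m∣n⇒∣m-n)
open import Data.Integer.Tactic.RingSolver using (solve-∀)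
open import Data.List.Base using (List; foldr; length; take; lookup; filterᵇ; deduplicate; allFin)
open import Data.List.Relation.Binary.Pointwise using (Pointwise)
open import Data.List.Relation.Unary.All using (All)
open import Data.Maybe.Base using (Maybe; just; nothing; is-nothing)
open import Data.Nat.Base as ℕ using (ℕ; suc)
open import Data.Nat.Divisibility using (>⇒∤; ∣1⇒≡1)
open import Data.Nat.GeneralisedArithmetic using (fold)
import Data.Nat.Properties as ℕ
open import Data.Product.Base using (Σ; ∃; ∃₂; _×_; _,_)
open import Data.Sum.Base using (_⊎_)
open import Data.Vec.Base as Vec using (Vec; tabulate)
open import Function.Bundles using (_↔_; Inverse; mk↔ₛ′)
open import Function.Construct.Composition using (_↔-∘_)
open import Function.Construct.Identity using (↔-id)
open import Function.Construct.Symmetry using (↔-sym)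
open import Algebra.Properties.Monoid.Sum ℤ.+-0-monoid using (sum)
open import Relation.Binary.Definitions using (Decidable)
open import Relation.Binary.PropositionalEquality
open import Relation.Nullary using (¬_; yes; no; does)
open import Relation.Unary using (Pred)

private
  i-j+j≡i : ∀ i j → i - j + j ≡ i
  i-j+j≡i = solve-∀

  i+j-j≡i : ∀ i j → i + j - j ≡ i
  i+j-j≡i = solve-∀

  i+j+l≡i+l+j : ∀ i j l → i + j + l ≡ i + l + j
  i+j+l≡i+l+j = solve-∀

  eq₁ : ∀ a c → (a + 1ℤ - c) - (a - c) ≡ 1ℤ
  eq₁ = solve-∀

  eq₂ : ∀ a c → a - c ≡ a + 1ℤ - (c + 1ℤ)
  eq₂ = solve-∀

  eq₃ : ∀ a c → a - (c + 1ℤ) ≡ a - 1ℤ - c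
  eq₃ = solve-∀

  eq₄ : ∀ x y s t m → x - y ≡ (x + t * m) - (y + s * m) + (s - t) * m
  eq₄ = solve-∀

  eq₅ : ∀ b s t m → (b + m - 1ℤ) - (b - 1ℤ) + (s - t) * m ≡ (s + 1ℤ - t) * m
  eq₅ = solve-∀

BijectiveOn : ∀ {A B : Set} → Pred A _ → Pred B _ → (A → B) → Set
BijectiveOn P Q φ =
    (∀ {x} → P x → Q (φ x))
  × (∀ {x y} → P x → P y → φ x ≡ φ y → x ≡ y)
  × (∀ {y} → Q y → ∃ λ x → P x × φ x ≡ y)

data Step : Set where
  right up : Step

isUp : Step → Bool
isUp right = false
isUp up    = true

-- A lattice path with n unit steps; its end point is (number of right steps , number of up steps).
Path : ℕ → Set
Path n = Vec Step n

_ᵁ : ∀ {n} → Path n → Subset n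
P ᵁ = Vec.map isUp P

module Affine (n : ℕ) (2≤n : 2 ℕ.≤ n) where

  instance
    n≢0 : ℕ.NonZero n
    n≢0 = ℕ.>-nonZero (ℕ.≤-trans (ℕ.s≤s ℕ.z≤n) 2≤n)

  -- Fin n stands for [n] = {1, …, n} through pos, except as the index set of s below.
  pos : Fin n → ℤ
  pos i = + suc (toℕ i)

  -- The inverse of pos modulo n.
  res : ℤ → Fin n
  res a = fromℕ< (n%ℕd<d (a - 1ℤ) n)

  record S̃ : Set where
    field
      bij      : ℤ ↔ ℤ
      periodic : ∀ i → Inverse.to bij (i + + n) ≡ Inverse.to bij i + + n

  open S̃

  infixl 20 _⟨$⟩_
  _⟨$⟩_ : S̃ → ℤ → ℤ
  f ⟨$⟩ a = Inverse.to (bij f) a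

  infix 4 _≈_
  _≈_ : S̃ → S̃ → Set
  f ≈ g = ∀ a → f ⟨$⟩ a ≡ g ⟨$⟩ a

  e : S̃
  e .bij        = ↔-id ℤ
  e .periodic _ = refl

  -- Products are read left to right: (f ∙ g) ⟨$⟩ a = g ⟨$⟩ (f ⟨$⟩ a).
  infixl 7 _∙_
  _∙_ : S̃ → S̃ → S̃
  (f ∙ g) .bij        = bij g ↔-∘ bij f
  (f ∙ g) .periodic i = trans (cong (g ⟨$⟩_) (periodic f i)) (periodic g (f ⟨$⟩ i))

  infix 8 _⁻¹
  _⁻¹ : S̃ → S̃
  (f ⁻¹) .bij        = ↔-sym (bij f)
  (f ⁻¹) .periodic i = Inverse.inverseʳ (bij f)
    (sym (trans (periodic f _) (cong (_+ + n) (Inverse.strictlyInverseˡ (bij f) i))))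

  -- Λ^ c is the c-th power of Λ : i ↦ i + 1.
  Λ^ : ℤ → S̃
  Λ^ c .bij        = mk↔ₛ′ (_+ c) (_- c) (λ a → i-j+j≡i a c) (λ a → i+j-j≡i a c)
  Λ^ c .periodic i = i+j+l≡i+l+j i (+ n) c

  n∤1 : ¬ (+ n ∣ 1ℤ)
  n∤1 d = ℕ.<⇒≢ 2≤n (sym (∣1⇒≡1 (∣⇒∣ᵤ d)))

  swap : ℤ → ℤ → ℤ
  swap c a with + n ∣? a - c
  ... | yes _ = a + 1ℤ
  ... | no  _ with + n ∣? a - (c + 1ℤ)
  ...   | yes _ = a - 1ℤ
  ...   | no  _ = a

  swap-involutive : ∀ c a → swap c (swap c a) ≡ a
  swap-involutive c a with + n ∣? a - c
  ... | yes p with + n ∣? a + 1ℤ - c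
  ...   | yes q = ⊥-elim (n∤1 (subst (+ n ∣_) (eq₁ a c) (∣m∣n⇒∣m-n q p)))
  ...   | no  _ with + n ∣? a + 1ℤ - (c + 1ℤ)
  ...     | yes _ = i+j-j≡i a 1ℤ
  ...     | no ¬r = ⊥-elim (¬r (subst (+ n ∣_) (eq₂ a c) p))
  swap-involutive c a | no ¬p with + n ∣? a - (c + 1ℤ)
  ...   | yes q with + n ∣? a - 1ℤ - c
  ...     | yes _ = i-j+j≡i a 1ℤ
  ...     | no ¬r = ⊥-elim (¬r (subst (+ n ∣_) (eq₃ a c) q))
  swap-involutive c a | no ¬p | no ¬q with + n ∣? a - c
  ...     | yes p = ⊥-elim (¬p p)
  ...     | no  _ with + n ∣? a - (c + 1ℤ)
  ...       | yes q = ⊥-elim (¬q q)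
  ...       | no  _ = refl

  ∣-up : ∀ a c → + n ∣ a - c → + n ∣ a + + n - c
  ∣-up a c p = subst (+ n ∣_) (i+j+l≡i+l+j a (- c) (+ n)) (∣m∣n⇒∣m+n p ∣-refl)

  ∣-down : ∀ a c → + n ∣ a + + n - c → + n ∣ a - c
  ∣-down a c p = subst (+ n ∣_) (trans (i+j+l≡i+l+j (a + + n) (- c) (- + n)) (cong (_- c) (i+j-j≡i a (+ n)))) (∣m∣n⇒∣m-n p (∣-refl {+ n}))

  swap-periodic : ∀ c a → swap c (a + + n) ≡ swap c a + + n
  swap-periodic c a with + n ∣? a - c | + n ∣? a + + n - c
  ... | yes _ | yes _ = i+j+l≡i+l+j a (+ n) 1ℤ
  ... | yes p | no ¬q = ⊥-elim (¬q (∣-up a c p))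
  ... | no ¬p | yes q = ⊥-elim (¬p (∣-down a c q))
  ... | no _  | no _ with + n ∣? a - (c + 1ℤ) | + n ∣? a + + n - (c + 1ℤ)
  ...   | yes _ | yes _ = i+j+l≡i+l+j a (+ n) (- 1ℤ)
  ...   | yes p | no ¬q = ⊥-elim (¬q (∣-up a (c + 1ℤ) p))
  ...   | no ¬p | yes q = ⊥-elim (¬p (∣-down a (c + 1ℤ) q))
  ...   | no _  | no _  = refl

  -- s i exchanges i + mn and i + 1 + mn; here i runs over 0, …, n - 1.
  s : Fin n → S̃
  s i .bij      = mk↔ₛ′ (swap c) (swap c) (swap-involutive c) (swap-involutive c)
    where c = + toℕ i
  s i .periodic = swap-periodic (+ toℕ i)

  res-periodic : ∀ a → res (a + + n) ≡ res a
  res-periodic a = Fin.fromℕ<-cong _ _ r′≡r _ _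
    where
    r  = (a - 1ℤ) %ℕ n
    q  = (a - 1ℤ) /ℕ n
    r′ = (a + + n - 1ℤ) %ℕ n
    q′ = (a + + n - 1ℤ) /ℕ n

    r′-r : + r′ - + r ≡ (q + 1ℤ - q′) * + n
    r′-r = begin
      + r′ - + r
        ≡⟨ eq₄ (+ r′) (+ r) q q′ (+ n) ⟩
      (+ r′ + q′ * + n) - (+ r + q * + n) + (q - q′) * + n
        ≡⟨ cong₂ (λ x y → x - y + (q - q′) * + n) (a≡a%ℕn+[a/ℕn]*n (a + + n - 1ℤ) n) (a≡a%ℕn+[a/ℕn]*n (a - 1ℤ) n) ⟨
      (a + + n - 1ℤ) - (a - 1ℤ) + (q - q′) * + n
        ≡⟨ eq₅ a q q′ (+ n) ⟩
      (q + 1ℤ - q′) * + n ∎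
      where
      open ≡-Reasoning

    ∣r′-r∣<n : ∣ + r′ - + r ∣ ℕ.< n
    ∣r′-r∣<n = ℕ.≤-<-trans
      (subst (λ x → ∣ x ∣ ℕ.≤ r′ ℕ.⊔ r) (sym (ℤ.m-n≡m⊖n r′ r)) (ℤ.∣m⊝n∣≤m⊔n r′ r))
      (ℕ.⊔-lub (n%ℕd<d (a + + n - 1ℤ) n) (n%ℕd<d (a - 1ℤ) n))

    r′≡r : r′ ≡ r
    r′≡r with ∣ + r′ - + r ∣ ℕ.≟ 0
    ... | yes z = ℤ.+-injective (ℤ.i-j≡0⇒i≡j (+ r′) (+ r) (ℤ.∣i∣≡0⇒i≡0 z))
    ... | no ¬z = ⊥-elim (>⇒∤ {{ℕ.≢-nonZero ¬z}} ∣r′-r∣<n (∣⇒∣ᵤ (divides (q + 1ℤ - q′) r′-r)))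

  res-lower : ∀ a → res (a - + n) ≡ res a
  res-lower a = trans (sym (res-periodic (a - + n))) (cong res (i-j+j≡i a (+ n)))

  raise lower : Subset n → ℤ → ℤ
  raise S a = if Vec.lookup S (res a) then a + + n else a
  lower S a = if Vec.lookup S (res a) then a - + n else a

  raise-lower : ∀ S a → raise S (lower S a) ≡ a
  raise-lower S a with Vec.lookup S (res a) in eq
  ... | false rewrite eq = refl
  ... | true  rewrite res-lower a | eq = i-j+j≡i a (+ n)

  lower-raise : ∀ S a → lower S (raise S a) ≡ a
  lower-raise S a with Vec.lookup S (res a) in eq
  ... | false rewrite eq = refl
  ... | true  rewrite res-periodic a | eq = i+j-j≡i a (+ n)

  raise-periodic : ∀ S a → raise S (a + + n) ≡ raise S a + + n
  raise-periodic S a rewrite res-periodic a with Vec.lookup S (res a)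
  ... | true  = refl
  ... | false = refl

  -- i ↦ i + n if i mod n ∈ S, and i ↦ i otherwise.
  τ : Subset n → S̃
  τ S .bij      = mk↔ₛ′ (raise S) (lower S) (raise-lower S) (lower-raise S)
  τ S .periodic = raise-periodic S

  τₖ : ℕ → S̃
  τₖ k = τ (tabulate λ i → does (toℕ i ℕ.<? k))

  -- Periodic extensions of permutations of [n].
  InSn : S̃ → Set
  InSn f = ∀ a → 1ℤ ≤ a → a ≤ + n → 1ℤ ≤ f ⟨$⟩ a × f ⟨$⟩ a ≤ + n

  -- Membership in the coset S̃ₙ⁽ᵏ⁾, with the factor 1/n cleared.
  InS̃ : ℕ → S̃ → Set
  InS̃ k f = sum (λ i → f ⟨$⟩ pos i - pos i) ≡ + k * + n

  InB : ℕ → S̃ → Set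
  InB k f = InS̃ k f × (∀ i → i ≤ f ⟨$⟩ i × f ⟨$⟩ i ≤ i + + n)

  Inversion : S̃ → Set
  Inversion f = Σ (ℤ × ℤ) λ (a , b) → 1ℤ ≤ a × a ≤ + n × a < b × f ⟨$⟩ b < f ⟨$⟩ a

  -- HasLength f m says ℓ(f) = m.  (The order relations on ℤ are propositions, so
  -- elements of Inversion f are determined by the pair (a , b).)
  HasLength : S̃ → ℕ → Set
  HasLength f m = Fin m ↔ Inversion f

  _ℓ<_ : S̃ → S̃ → Set
  f ℓ< g = ∃₂ λ p q → HasLength f p × HasLength g q × p ℕ.< q

  -- Reflections of the Coxeter group S̃ₙ⁽⁰⁾: the conjugates of the s i.
  Reflection : S̃ → Set
  Reflection t = ∃₂ λ g i → InS̃ 0 g × t ≈ g ∙ s i ∙ g ⁻¹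

  -- Bruhat order: u ≤ᴮ v if v is reached from u by right multiplications by
  -- reflections, each of which increases the length.
  infix 4 _≤ᴮ_
  data _≤ᴮ_ (u v : S̃) : Set where
    stop : u ≈ v → u ≤ᴮ v
    step : ∀ {u′ t} → Reflection t → u′ ≈ u ∙ t → u ℓ< u′ → u′ ≤ᴮ v → u ≤ᴮ v

  Word : Set
  Word = List (Fin n)

  word : Word → S̃
  word = foldr (λ i g → s i ∙ g) e

  IsReducedWord : ℕ → S̃ → Word → Set
  IsReducedWord k f 𝐠 = word 𝐠 ≈ Λ^ (- + k) ∙ f × HasLength f (length 𝐠)

  -- The usual notion for w ∈ Sₙ, with letters s₁, …, sₙ₋₁.
  IsReducedWordSn : S̃ → Word → Set
  IsReducedWordSn w 𝐰 = All (λ i → 1 ℕ.≤ toℕ i) 𝐰 × word 𝐰 ≈ w × HasLength w (length 𝐰)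

  -- In a subword, just i stands for the selected letter s i and nothing for e.
  Entry : Set
  Entry = Maybe (Fin n)

  entry : Entry → S̃
  entry (just i) = s i
  entry nothing  = e

  product : List Entry → S̃
  product = foldr (λ u g → entry u ∙ g) e

  _₍_₎ : List Entry → ℕ → S̃
  𝐮 ₍ j ₎ = product (take j 𝐮)

  IsSubword : Word → List Entry → Set
  IsSubword = Pointwise λ i u → u ≡ just i ⊎ u ≡ nothing

  -- The (zero-based) position j here is j + 1 in the usual indexing of letters.
  Distinguished : Word → List Entry → Set
  Distinguished 𝐠 𝐮 = ∀ (j : Fin (length 𝐠)) →
    𝐮 ₍ suc (toℕ j) ₎ ≤ᴮ 𝐮 ₍ toℕ j ₎ ∙ s (lookup 𝐠 j)

  #e : List Entry → ℕ
  #e 𝐮 = length (filterᵇ is-nothing 𝐮)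

  𝓓 : ℕ → S̃ → Word → Pred (List Entry) _
  𝓓 r v 𝐰 𝐮 = IsSubword 𝐰 𝐮 × Distinguished 𝐰 𝐮 × 𝐮 ₍ length 𝐰 ₎ ≈ v × #e 𝐮 ≡ r

  𝓐 : ℕ → ℕ → S̃ → Word → Pred (List Entry) _
  𝓐 k r f 𝐠 𝐮 = IsSubword 𝐠 𝐮 × Distinguished 𝐠 𝐮 × 𝐮 ₍ length 𝐠 ₎ ≈ Λ^ (- + k) ∙ f × #e 𝐮 ≡ r

  Grassmannian : ℕ → S̃ → Set
  Grassmannian k w =
      (∀ a b → 1ℤ ≤ a → a < b → b ≤ + k → w ⟨$⟩ a < w ⟨$⟩ b)
    × (∀ a b → + suc k ≤ a → a < b → b ≤ + n → w ⟨$⟩ a < w ⟨$⟩ b)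

  x : ℕ → S̃ → S̃
  x k w = w ⁻¹ ∙ τₖ k

  -- The image w([k]), as a subset of [n].
  image : ℕ → S̃ → Subset n
  image k w = tabulate λ i →
    does (Fin.any? λ (j : Fin k) → w ⟨$⟩ (+ suc (toℕ j)) ℤ.≟ pos i)

  -- The lattice path with up-step set w([k]); for w ∈ Sₙ it ends at (n - k , k).
  P : ℕ → S̃ → Path n
  P k w = Vec.map (λ b → if b then up else right) (image k w)

  reduce : S̃ → Fin n → Fin n
  reduce f i = res (f ⟨$⟩ pos i)

  -- A cycle of a permutation of [n] has at most n elements, so exponents below n suffice.
  SameCycle : (Fin n → Fin n) → Fin n → Fin n → Set
  SameCycle σ i j = ∃ λ (m : Fin n) → fold i σ (toℕ m) ≡ j

  sameCycle? : ∀ σ → Decidable (SameCycle σ)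
  sameCycle? σ i j = Fin.any? λ m → fold i σ (toℕ m) Fin.≟ j

  cycles : (Fin n → Fin n) → ℕ
  cycles σ = length (deduplicate (sameCycle? σ) (allFin n))

  r₀ : S̃ → ℕ
  r₀ f = n ℕ.∸ cycles (reduce f)

  DeoMax : S̃ → S̃ → Word → Pred (List Entry) _
  DeoMax f v 𝐰 = 𝓓 (r₀ f) v 𝐰

  AffineDeoMax : ℕ → S̃ → Word → Pred (List Entry) _
  AffineDeoMax k f 𝛕 = 𝓐 k (r₀ f) f 𝛕

  I₁ : S̃ → Pred (Fin n) _
  I₁ f i = ∃ λ a → a < 1ℤ × 1ℤ ≤ f ⟨$⟩ a × res a ≡ i

{-# OPTIONS --safe #-}
module Submission where

open import Data.Bool.Base using (true; false; if_then_else_)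
open import Data.Empty using (⊥; ⊥-elim)
open import Data.Fin.Base as Fin using (Fin; toℕ; fromℕ<; zero; suc)
import Data.Fin.Properties as Fin
open import Data.Fin.Permutation using (Permutation)
open import Data.Fin.Subset using (Subset; _∈_)
open import Data.Integer.Base using (ℤ; +_; -_; 0ℤ; 1ℤ; -[1+_]; +[1+_]; _+_; _-_; _*_; _≤_; _<_; _%ℕ_; _/ℕ_; ∣_∣; +≤+; +<+; -≤+)
import Data.Integer.Properties as ℤ
open import Data.Integer.DivMod using (n%ℕd<d; a≡a%ℕn+[a/ℕn]*n)
open import Data.Integer.Divisibility.Signed using (_∣_; _∣?_; divides)
open import Data.Integer.Tactic.RingSolver using (solve-∀)
open import Data.List.Base using (List; []; _∷_; _++_; length; take; lookup; map; catMaybes)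
open import Data.List.Properties using (++-cancelˡ; length-++)
open import Data.List.Relation.Binary.Pointwise using ([]; _∷_)
open import Data.List.Relation.Unary.All using (All; []; _∷_)
open import Data.Maybe.Base using (just; nothing)
open import Data.Nat.Base as ℕ using (ℕ; zero; suc)
import Data.Nat.Properties as ℕ
open import Data.Product.Base using (Σ; ∃; ∃₂; _×_; _,_; proj₁; proj₂)
open import Data.Sum.Base using (_⊎_; inj₁; inj₂)
open import Data.Sum.Function.Propositional using (_⊎-↔_)
open import Data.Unit.Base using (⊤; tt)
open import Data.Vec.Base as Vec using ([]; _∷_)
open import Data.Vec.Properties using (lookup∘tabulate; lookup⇒[]=; []=⇒lookup)
open import Function.Base using (_∘_)
open import Function.Bundles using (_↔_; Inverse; Injection; mk↔ₛ′)
open import Function.Construct.Composition using (_↔-∘_)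
open import Function.Construct.Symmetry using (↔-sym)
open import Function.Definitions using (Injective)
open import Function.Properties.Inverse using (↔⇒↣)
open import Relation.Binary.Definitions using (tri<; tri≈; tri>)
open import Relation.Binary.PropositionalEquality
open import Relation.Nullary using (¬_; Dec; yes; no; does; Irrelevant; contradiction)
open import Relation.Nullary.Decidable using (_×-dec_; dec-true; dec-false)
open import Relation.Unary using (_≐_)
open import Defs

open import Algebra.Properties.CommutativeMonoid.Sum ℤ.+-0-commutativeMonoid using (sum; sum-cong-≗; sum-replicate-zero; ∑-distrib-+; sum-permute)

-- Write x = x_w.  Since w is Grassmannian, x⁻¹ is increasing on [n], so x is the element of
-- minimal length in its coset x Sₙ.  Let 𝐲 𝐮 be a subword of 𝐱 𝐰 with product Λ⁻ᵏ x v.  The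
-- product of 𝐮 lies in Sₙ, so the product of 𝐲 lies in Λ⁻ᵏ x Sₙ and has length at least
-- ℓ(x) = length 𝐱; hence 𝐲 selects every letter of 𝐱.  A letter s_i may be skipped after the
-- partial product h exactly when h⁻¹(i) < h⁻¹(i+1), and for h ∈ Sₙ and 1 ≤ i < n this does not
-- change when h is replaced by x h, again because x⁻¹ is increasing on [n].
--
-- Lengths are compared through injections between sets of inversions.  The bounds
-- i ≤ f(i) ≤ i + n come from v(j) ≤ w(j) for j ≤ k and w(j) ≤ v(j) for j > k: along a Bruhat
-- chain, the property that some a ≤ i has u(a) ≥ j is preserved, and so is its dual.

-- The obstacle is to read positions off lengths: a chain from h to h s_i yields only ℓ(h) < ℓ(h
-- s_i), whereas the skipping criterion compares h⁻¹(i) with h⁻¹(i+1). The bridge concerns any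
-- reflection t: if ℓ(u) < ℓ(ut), then every value a that t raises stands in u to the left of t(a).
-- This is proved by contraposition. The points raised by t form a single class modulo n, so one
-- such pair in the wrong order puts all of them in the wrong order, and then the inversions of ut
-- inject into those of u. The same bridge controls every step of a Bruhat chain.

≤-from : ∀ {i j p q} → i ≤ j → j - i ≡ q - p → p ≤ q
≤-from i≤j eq = ℤ.0≤i-j⇒j≤i (subst (0ℤ ≤_) eq (ℤ.i≤j⇒0≤j-i i≤j))

-- As with `≤-from`, an inequality is transported along an identity of differences, which is what
-- the ring solver can prove.
<-from : ∀ {i j p q} → i < j → j - i ≡ q - p → p < q
<-from {i} {j} {p} {q} i<j eq =
  subst₂ _<_ (cancel i p) (trans (swap-sub i j p) (trans (cong (_+ p) eq) (i-j+j≡i q p))) (ℤ.+-monoˡ-< (p - i) i<j)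
  where
  cancel : ∀ i p → i + (p - i) ≡ p
  cancel = solve-∀
  swap-sub : ∀ i j p → j + (p - i) ≡ j - i + p
  swap-sub = solve-∀
  i-j+j≡i : ∀ i j → i - j + j ≡ i
  i-j+j≡i = solve-∀

<⇒1+≤ : ∀ {i j} → i < j → i + 1ℤ ≤ j
<⇒1+≤ {i} i<j = subst (_≤ _) (ℤ.+-comm 1ℤ i) (ℤ.i<j⇒suc[i]≤j i<j)

1+≤⇒< : ∀ {i j} → i + 1ℤ ≤ j → i < j
1+≤⇒< {i} i+1≤j = ℤ.suc[i]≤j⇒i<j (subst (_≤ _) (ℤ.+-comm i 1ℤ) i+1≤j)

≢∧≮⇒> : ∀ {i j} → i ≢ j → ¬ i < j → j < i
≢∧≮⇒> {i} {j} i≢j i≮j = ℤ.≤∧≢⇒< (ℤ.≮⇒≥ i≮j) (i≢j ∘ sym)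

+-unshift-< : ∀ {i j} c → i + c < j + c → i < j
+-unshift-< {i} {j} c lt = <-from lt (eq i j c)
  where
  eq : ∀ i j c → j + c - (i + c) ≡ j - i
  eq = solve-∀

-- Finite sets and cardinalities

card-≤ : ∀ {A B : Set} {p q} → Fin p ↔ A → Fin q ↔ B → (φ : A → B) → Injective _≡_ _≡_ φ → p ℕ.≤ q
card-≤ p↔A q↔B φ φ-inj =
  Fin.injective⇒≤ {f = Inverse.from q↔B ∘ φ ∘ Inverse.to p↔A}
    (Injection.injective (↔⇒↣ p↔A) ∘ φ-inj ∘ Injection.injective (↔⇒↣ (↔-sym q↔B)))

Finite : Set → Set
Finite A = ∃ λ m → Fin m ↔ A

dec⇒finite : ∀ {A : Set} → Irrelevant A → Dec A → Finite A
dec⇒finite irr (yes a) = 1 , mk↔ₛ′ (λ _ → a) (λ _ → zero) (irr a) (λ { zero → refl })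
dec⇒finite irr (no ¬a) = 0 , mk↔ₛ′ (λ ()) (λ a → ⊥-elim (¬a a)) (λ a → ⊥-elim (¬a a)) (λ ())

Σ-finite : ∀ {m} {B : Fin m → Set} → (∀ i → Finite (B i)) → Finite (Σ (Fin m) B)
Σ-finite {zero}      _   = 0 , mk↔ₛ′ (λ ()) (λ ()) (λ ()) (λ ())
Σ-finite {suc m} {B} fin with fin zero | Σ-finite (fin ∘ suc)
... | p , p↔ | q , q↔ = p ℕ.+ q , split ↔-∘ ((p↔ ⊎-↔ q↔) ↔-∘ Fin.+↔⊎)
  where
  split : (B zero ⊎ Σ (Fin m) (B ∘ suc)) ↔ Σ (Fin (suc m)) B
  split = mk↔ₛ′
    (λ { (inj₁ b) → zero , b ; (inj₂ (i , b)) → suc i , b })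
    (λ { (zero , b) → inj₁ b ; (suc i , b) → inj₂ (i , b) })
    (λ { (zero , b) → refl ; (suc i , b) → refl })
    (λ { (inj₁ b) → refl ; (inj₂ (i , b)) → refl })

bounded : ∀ {m} (h : Fin m → ℤ) → ∃ λ D → ∀ i → - + D ≤ h i × h i ≤ + D
bounded {zero}  h = 0 , λ ()
bounded {suc m} h with bounded (h ∘ suc)
... | D , bd = ∣ h zero ∣ ℕ.⊔ D , λ where
    zero    → widen (ℕ.m≤m⊔n ∣ h zero ∣ D) (-∣i∣≤i (h zero) , i≤∣i∣ (h zero))
    (suc i) → widen (ℕ.m≤n⊔m ∣ h zero ∣ D) (bd i)
  where
  i≤∣i∣ : ∀ i → i ≤ + ∣ i ∣
  i≤∣i∣ (+ _)    = ℤ.≤-refl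
  i≤∣i∣ -[1+ _ ] = -≤+

  -∣i∣≤i : ∀ i → - + ∣ i ∣ ≤ i
  -∣i∣≤i (+ zero)  = ℤ.≤-refl
  -∣i∣≤i +[1+ _ ]  = -≤+
  -∣i∣≤i -[1+ _ ]  = ℤ.≤-refl

  widen : ∀ {p q i} → p ℕ.≤ q → - + p ≤ i × i ≤ + p → - + q ≤ i × i ≤ + q
  widen p≤q (lo , hi) = ℤ.≤-trans (ℤ.neg-mono-≤ (+≤+ p≤q)) lo , ℤ.≤-trans hi (+≤+ p≤q)

sum-indicator : ∀ {m} k c → k ℕ.≤ m → sum {m} (λ j → if does (toℕ j ℕ.<? k) then c else 0ℤ) ≡ + k * c
sum-indicator {m}     zero    c _           = sum-replicate-zero m
sum-indicator {suc m} (suc k) c (ℕ.s≤s k≤m) = trans (cong (λ S → c + S) (sum-indicator k c k≤m)) (eq (+ k) c)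
  where
  eq : ∀ k c → c + k * c ≡ (1ℤ + k) * c
  eq = solve-∀

path-up-steps : ∀ {m} (S : Subset m) → Vec.map isUp (Vec.map (λ b → if b then up else right) S) ≡ S
path-up-steps []          = refl
path-up-steps (true ∷ S)  = cong (true ∷_) (path-up-steps S)
path-up-steps (false ∷ S) = cong (false ∷_) (path-up-steps S)

module Lemmas (n : ℕ) (2≤n : 2 ℕ.≤ n) where

  open Affine n 2≤n
  open S̃

  -- Residues modulo n

  InRange : ℤ → Set
  InRange a = 1ℤ ≤ a × a ≤ + n

  n≤m*n : ∀ {m} → 0ℤ < m → + n ≤ m * + n
  n≤m*n {m} 0<m = subst (_≤ m * + n) (ℤ.*-identityˡ (+ n)) (ℤ.*-monoʳ-≤-nonNeg (+ n) (ℤ.i<j⇒suc[i]≤j 0<m))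

  1+n≰n : ¬ (1ℤ + + n ≤ + n)
  1+n≰n le = ℤ.<-irrefl refl (ℤ.suc[i]≤j⇒i<j le)

  block-≤ : ∀ {r} m → 1ℤ ≤ r → r + m * + n ≤ + n → m ≤ 0ℤ
  block-≤ m 1≤r le = ℤ.≮⇒≥ λ 0<m → 1+n≰n (ℤ.≤-trans (ℤ.+-mono-≤ 1≤r (n≤m*n 0<m)) le)

  block-≥ : ∀ {r} m → r ≤ + n → 1ℤ ≤ r + m * + n → 0ℤ ≤ m
  block-≥ {r} m r≤n le = ℤ.≮⇒≥ λ m<0 →
    1+n≰n (ℤ.≤-trans (ℤ.+-mono-≤ le (n≤m*n (ℤ.neg-mono-< m<0))) (≤-from r≤n (eq r m (+ n))))
    where
    eq : ∀ r m N → N - r ≡ N - (r + m * N + - m * N)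
    eq = solve-∀

  range-unique : ∀ {r} m → InRange r → InRange (r + m * + n) → m ≡ 0ℤ
  range-unique m (1≤r , r≤n) (1≤r′ , r′≤n) = ℤ.≤-antisym (block-≤ m 1≤r r′≤n) (block-≥ m r≤n 1≤r′)

  +0*n : ∀ {a m} → m ≡ 0ℤ → a + m * + n ≡ a
  +0*n {a} refl = ℤ.+-identityʳ a

  -- Dividing a - 1 makes the shifted remainder range over 1, ..., n, in agreement with `res`.
  quot : ℤ → ℤ
  quot a = (a - 1ℤ) /ℕ n

  pos∘res : ∀ a → a ≡ pos (res a) + quot a * + n
  pos∘res a = begin
    a                                          ≡⟨ eq₁ a ⟩
    1ℤ + (a - 1ℤ)                              ≡⟨ cong (λ b → 1ℤ + b) (a≡a%ℕn+[a/ℕn]*n (a - 1ℤ) n) ⟩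
    1ℤ + (+ ((a - 1ℤ) %ℕ n) + quot a * + n)    ≡⟨ ℤ.+-assoc 1ℤ (+ ((a - 1ℤ) %ℕ n)) (quot a * + n) ⟨
    + suc ((a - 1ℤ) %ℕ n) + quot a * + n       ≡⟨ cong (λ r → + suc r + quot a * + n) (Fin.toℕ-fromℕ< (n%ℕd<d (a - 1ℤ) n)) ⟨
    pos (res a) + quot a * + n                 ∎
    where
    open ≡-Reasoning
    eq₁ : ∀ a → a ≡ 1ℤ + (a - 1ℤ)
    eq₁ = solve-∀

  pos-range : ∀ i → InRange (pos i)
  pos-range i = +≤+ (ℕ.s≤s ℕ.z≤n) , +≤+ (Fin.toℕ<n i)

  pos-injective : ∀ {i j} → pos i ≡ pos j → i ≡ j
  pos-injective eq = Fin.toℕ-injective (ℕ.suc-injective (ℤ.+-injective eq))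

  shift-sub : ∀ {a r} q → a ≡ r + q * + n → r ≡ a + - q * + n
  shift-sub {r = r} q refl = eq r q (+ n)
    where
    eq : ∀ r q N → r ≡ r + q * N + - q * N
    eq = solve-∀

  mod-unique : ∀ {a b} m → InRange a → InRange b → a ≡ b + m * + n → a ≡ b
  mod-unique m a∈ b∈ refl = +0*n (range-unique m b∈ a∈)

  pos∘res-range : ∀ {a} → InRange a → pos (res a) ≡ a
  pos∘res-range {a} a∈ = sym (mod-unique (quot a) a∈ (pos-range (res a)) (pos∘res a))

  to-range : ∀ a → ∃ λ m → InRange (a + m * + n)
  to-range a = - quot a , subst InRange (shift-sub (quot a) (pos∘res a)) (pos-range (res a))

  -- Periodicity

  ⟨$⟩-shift⁺ : ∀ f a m → f ⟨$⟩ (a + + m * + n) ≡ f ⟨$⟩ a + + m * + n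
  ⟨$⟩-shift⁺ f a zero    = trans (cong (f ⟨$⟩_) (ℤ.+-identityʳ a)) (sym (ℤ.+-identityʳ _))
  ⟨$⟩-shift⁺ f a (suc m) = begin
    f ⟨$⟩ (a + + suc m * + n)      ≡⟨ cong (f ⟨$⟩_) (eq a (+ m) (+ n)) ⟩
    f ⟨$⟩ (a + + m * + n + + n)    ≡⟨ periodic f _ ⟩
    f ⟨$⟩ (a + + m * + n) + + n    ≡⟨ cong (_+ + n) (⟨$⟩-shift⁺ f a m) ⟩
    f ⟨$⟩ a + + m * + n + + n      ≡⟨ eq (f ⟨$⟩ a) (+ m) (+ n) ⟨
    f ⟨$⟩ a + + suc m * + n        ∎
    where
    open ≡-Reasoning
    eq : ∀ a m N → a + (1ℤ + m) * N ≡ a + m * N + N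
    eq = solve-∀

  ⟨$⟩-shift : ∀ f a m → f ⟨$⟩ (a + m * + n) ≡ f ⟨$⟩ a + m * + n
  ⟨$⟩-shift f a (+ m)    = ⟨$⟩-shift⁺ f a m
  ⟨$⟩-shift f a -[1+ m ] = begin
    f ⟨$⟩ (a + - M * + n)                        ≡⟨ eq (f ⟨$⟩ (a + - M * + n)) M (+ n) ⟩
    f ⟨$⟩ (a + - M * + n) + M * + n + - M * + n  ≡⟨ cong (_+ - M * + n) (⟨$⟩-shift⁺ f (a + - M * + n) (suc m)) ⟨
    f ⟨$⟩ (a + - M * + n + M * + n) + - M * + n  ≡⟨ cong (λ b → f ⟨$⟩ b + - M * + n) (eq′ a M (+ n)) ⟩
    f ⟨$⟩ a + - M * + n                          ∎
    where
    open ≡-Reasoning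
    M = + suc m
    eq : ∀ a m N → a ≡ a + m * N + - m * N
    eq = solve-∀
    eq′ : ∀ a m N → a + - m * N + m * N ≡ a
    eq′ = solve-∀

  ⁻¹-cancelˡ : ∀ f a → (f ⁻¹) ⟨$⟩ (f ⟨$⟩ a) ≡ a
  ⁻¹-cancelˡ f = Inverse.strictlyInverseʳ (bij f)

  ⁻¹-cancelʳ : ∀ f a → f ⟨$⟩ ((f ⁻¹) ⟨$⟩ a) ≡ a
  ⁻¹-cancelʳ f = Inverse.strictlyInverseˡ (bij f)

  ⟨$⟩-injective : ∀ f {a b} → f ⟨$⟩ a ≡ f ⟨$⟩ b → a ≡ b
  ⟨$⟩-injective f {a} {b} eq = trans (sym (⁻¹-cancelˡ f a)) (trans (cong ((f ⁻¹) ⟨$⟩_) eq) (⁻¹-cancelˡ f b))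

  ⁻¹-cong : ∀ {f g} → f ≈ g → f ⁻¹ ≈ g ⁻¹
  ⁻¹-cong {f} {g} f≈g a =
    ⟨$⟩-injective g (trans (sym (f≈g _)) (trans (⁻¹-cancelʳ f a) (sym (⁻¹-cancelʳ g a))))

  -- Lengths

  inversion-≡ : ∀ f {x y : Inversion f} → proj₁ x ≡ proj₁ y → x ≡ y
  inversion-≡ _ {_ , p₁ , p₂ , p₃ , p₄} {_ , q₁ , q₂ , q₃ , q₄} refl
    rewrite ℤ.≤-irrelevant p₁ q₁ | ℤ.≤-irrelevant p₂ q₂ | ℤ.<-irrelevant p₃ q₃ | ℤ.<-irrelevant p₄ q₄ = refl

  fromRange : ∀ {m a} → 1ℤ ≤ a → a ≤ + m → ∃ λ (i : Fin m) → + suc (toℕ i) ≡ a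
  fromRange {a = + suc a} _ (+≤+ a<m) = fromℕ< a<m , cong (λ r → + suc r) (Fin.toℕ-fromℕ< a<m)
  fromRange {a = + zero}  (+≤+ ()) _

  -- Let D bound |f| on [n] and write b = r + qn with r in [n]. If a is in [n] and f(b) < f(a), then
  -- -D + qn ≤ f(b) < D, so qn ≤ 2D and b ≤ n + 2D. Since 1 ≤ a < b, only finitely many pairs
  -- remain, and the conditions on them are decidable.
  inversions-finite : ∀ f → Finite (Inversion f)
  inversions-finite f with bounded (λ i → f ⟨$⟩ pos i)
  ... | D , bd = proj₁ code-finite , mk↔ₛ′ decode encode (λ x → inversion-≡ f (decode-encode x)) encode-decode ↔-∘ proj₂ code-finite
    where
    M : ℕ
    M = n ℕ.+ (D ℕ.+ D)

    Code : Set
    Code = Σ (Fin n) λ i → Σ (Fin M) λ j → pos i < + suc (toℕ j) × f ⟨$⟩ (+ suc (toℕ j)) < f ⟨$⟩ pos i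

    code-finite : Finite Code
    code-finite = Σ-finite λ i → Σ-finite λ j → dec⇒finite
      (λ (p , q) (p′ , q′) → cong₂ _,_ (ℤ.<-irrelevant p p′) (ℤ.<-irrelevant q q′))
      ((_ ℤ.<? _) ×-dec (_ ℤ.<? _))

    code-≡ : ∀ {x y : Code} → pos (proj₁ x) ≡ pos (proj₁ y) →
             + suc (toℕ (proj₁ (proj₂ x))) ≡ + suc (toℕ (proj₁ (proj₂ y))) → x ≡ y
    code-≡ {_ , _ , p , q} {_ , _ , p′ , q′} eq₁ eq₂
      with pos-injective eq₁ | Fin.toℕ-injective (ℕ.suc-injective (ℤ.+-injective eq₂))
    ... | refl | refl rewrite ℤ.<-irrelevant p p′ | ℤ.<-irrelevant q q′ = refl

    bound : ∀ {a b} → InRange a → f ⟨$⟩ b < f ⟨$⟩ a → b ≤ + M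
    bound {a} {b} a∈ fb<fa = ≤-from
      (ℤ.+-mono-≤ (proj₂ (pos-range (res b))) (ℤ.+-mono-≤ (proj₁ (bd (res b))) fb≤D))
      (trans (eq (pos (res b)) (+ D) (f ⟨$⟩ pos (res b)) (quot b * + n) (+ n)) (cong (λ c → + M - c) (sym (pos∘res b))))
      where
      eq : ∀ p D F Q N → N + (F + D) - (p + (- D + (F + Q))) ≡ N + (D + D) - (p + Q)
      eq = solve-∀
      fb≤D : f ⟨$⟩ pos (res b) + quot b * + n ≤ + D
      fb≤D = begin
        f ⟨$⟩ pos (res b) + quot b * + n    ≡⟨ ⟨$⟩-shift f (pos (res b)) (quot b) ⟨
        f ⟨$⟩ (pos (res b) + quot b * + n)  ≡⟨ cong (f ⟨$⟩_) (pos∘res b) ⟨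
        f ⟨$⟩ b                             ≤⟨ ℤ.<⇒≤ fb<fa ⟩
        f ⟨$⟩ a                             ≡⟨ cong (f ⟨$⟩_) (pos∘res-range a∈) ⟨
        f ⟨$⟩ pos (res a)                   ≤⟨ proj₂ (bd (res a)) ⟩
        + D                                 ∎
        where open ℤ.≤-Reasoning

    decode : Code → Inversion f
    decode (i , j , i<j , fj<fi) = (pos i , + suc (toℕ j)) , proj₁ (pos-range i) , proj₂ (pos-range i) , i<j , fj<fi

    encode : Inversion f → Code
    encode ((a , b) , 1≤a , a≤n , a<b , fb<fa)
      with fromRange 1≤a a≤n | fromRange (ℤ.≤-trans 1≤a (ℤ.<⇒≤ a<b)) (bound (1≤a , a≤n) fb<fa)
    ... | i , refl | j , refl = i , j , a<b , fb<fa

    decode-encode : ∀ x → proj₁ (decode (encode x)) ≡ proj₁ x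
    decode-encode ((a , b) , 1≤a , a≤n , a<b , fb<fa)
      with fromRange 1≤a a≤n | fromRange (ℤ.≤-trans 1≤a (ℤ.<⇒≤ a<b)) (bound (1≤a , a≤n) fb<fa)
    ... | i , refl | j , refl = refl

    encode-decode : ∀ x → encode (decode x) ≡ x
    encode-decode x = code-≡ (cong proj₁ (decode-encode (decode x))) (cong proj₂ (decode-encode (decode x)))

  abstract
    -- Opaque, so that no later goal unfolds the enumeration; lengths are handled only through
    -- `hasLength-ℓ`.
    ℓ : S̃ → ℕ
    ℓ f = proj₁ (inversions-finite f)

    hasLength-ℓ : ∀ f → HasLength f (ℓ f)
    hasLength-ℓ f = proj₂ (inversions-finite f)

  hasLength⇒≡ℓ : ∀ f {p} → HasLength f p → p ≡ ℓ f
  hasLength⇒≡ℓ f h = ℕ.≤-antisym (card-≤ h (hasLength-ℓ f) (λ x → x) (λ eq → eq)) (card-≤ (hasLength-ℓ f) h (λ x → x) (λ eq → eq))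

  ℓ-mono-⊆ : ∀ f g → (∀ {a b} → a < b → f ⟨$⟩ b < f ⟨$⟩ a → g ⟨$⟩ b < g ⟨$⟩ a) → ℓ f ℕ.≤ ℓ g
  ℓ-mono-⊆ f g f⊆g = card-≤ (hasLength-ℓ f) (hasLength-ℓ g)
    (λ (ab , 1≤a , a≤n , a<b , inv) → ab , 1≤a , a≤n , a<b , f⊆g a<b inv)
    (λ eq → inversion-≡ f (cong proj₁ eq))

  ℓ-cong : ∀ {f g} → f ≈ g → ℓ f ≡ ℓ g
  ℓ-cong {f} {g} f≈g = ℕ.≤-antisym
    (ℓ-mono-⊆ f g λ {a} {b} _ → subst₂ _<_ (f≈g b) (f≈g a))
    (ℓ-mono-⊆ g f λ {a} {b} _ → subst₂ _<_ (sym (f≈g b)) (sym (f≈g a)))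

  ℓ<⇒ : ∀ {f g} → f ℓ< g → ℓ f ℕ.< ℓ g
  ℓ<⇒ {f} {g} (p , q , hf , hg , p<q) = subst₂ ℕ._<_ (hasLength⇒≡ℓ f hf) (hasLength⇒≡ℓ g hg) p<q

  ⇒ℓ< : ∀ {f g} → ℓ f ℕ.< ℓ g → f ℓ< g
  ⇒ℓ< {f} {g} lt = ℓ f , ℓ g , hasLength-ℓ f , hasLength-ℓ g , lt

  -- The shift m is returned because the injectivity arguments have to undo it.
  normalise : ∀ f {a b} → a < b → f ⟨$⟩ b < f ⟨$⟩ a → ∃ λ m → Σ (Inversion f) λ x → proj₁ x ≡ (a + m * + n , b + m * + n)
  normalise f {a} {b} a<b fb<fa with to-range a
  ... | m , 1≤ , ≤n = m , ((a + m * + n , b + m * + n) , 1≤ , ≤n , ℤ.+-monoˡ-< (m * + n) a<b ,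
    subst₂ _<_ (sym (⟨$⟩-shift f b m)) (sym (⟨$⟩-shift f a m)) (ℤ.+-monoˡ-< (m * + n) fb<fa)) , refl

  -- Reflections

  ≡+⇐-≡ : ∀ {a c m} → a - c ≡ m → a ≡ c + m
  ≡+⇐-≡ {a} {c} refl = eq a c
    where
    eq : ∀ a c → a ≡ c + (a - c)
    eq = solve-∀

  swap-view : ∀ c a →
      (∃ λ q → a ≡ c + q * + n × swap c a ≡ a + 1ℤ)
    ⊎ (∃ λ q → a ≡ c + 1ℤ + q * + n × swap c a ≡ a - 1ℤ)
    ⊎ swap c a ≡ a
  swap-view c a with + n ∣? a - c
  ... | yes (divides q eq) = inj₁ (q , ≡+⇐-≡ eq , refl)
  ... | no _ with + n ∣? a - (c + 1ℤ)
  ...   | yes (divides q eq) = inj₂ (inj₁ (q , ≡+⇐-≡ eq , refl))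
  ...   | no _ = inj₂ (inj₂ refl)

  swap-base : ∀ c → swap c c ≡ c + 1ℤ
  swap-base c with + n ∣? c - c
  ... | yes _ = refl
  ... | no ¬d = contradiction (divides 0ℤ (ℤ.+-inverseʳ c)) ¬d

  i-1≤i : ∀ i → i - 1ℤ ≤ i
  i-1≤i i = ℤ.i≤j⇒i-k≤j 1ℤ ℤ.≤-refl

  i≤i+1 : ∀ i → i ≤ i + 1ℤ
  i≤i+1 i = ℤ.<⇒≤ (1+≤⇒< ℤ.≤-refl)

  swap-lower : ∀ c a → a - 1ℤ ≤ swap c a
  swap-lower c a with swap-view c a
  ... | inj₁ (_ , _ , eq)        rewrite eq = ℤ.≤-trans (i-1≤i a) (i≤i+1 a)
  ... | inj₂ (inj₁ (_ , _ , eq)) rewrite eq = ℤ.≤-refl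
  ... | inj₂ (inj₂ eq)           rewrite eq = i-1≤i a

  -- `swap` moves a value by at most one, so q - 1 < swap c p. If p is not raised this contradicts p
  -- < q; if it is raised it gives q ≤ p + 1.
  swap-inverts : ∀ c {p q} → p < q → swap c q < swap c p → ∃ λ m → p ≡ c + m * + n × q ≡ p + 1ℤ
  swap-inverts c {p} {q} p<q inv with swap-view c p
  ... | inj₁ (m , p≡ , eq) = m , p≡ , ℤ.≤-antisym q≤p+1 (<⇒1+≤ p<q)
    where
    q≤p+1 : q ≤ p + 1ℤ
    q≤p+1 = subst₂ _≤_ (cancel q) eq (<⇒1+≤ (ℤ.≤-<-trans (swap-lower c q) inv))
      where
      cancel : ∀ q → q - 1ℤ + 1ℤ ≡ q
      cancel = solve-∀
  ... | inj₂ down = contradiction p<q (ℤ.≤⇒≯ q≤p)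
    where
    not-raised : (∃ λ m → p ≡ c + 1ℤ + m * + n × swap c p ≡ p - 1ℤ) ⊎ swap c p ≡ p → swap c p ≤ p
    not-raised (inj₁ (_ , _ , eq)) = subst (_≤ p) (sym eq) (i-1≤i p)
    not-raised (inj₂ eq)           = ℤ.≤-reflexive eq

    q≤p : q ≤ p
    q≤p = subst (_≤ p) (cancel q) (<⇒1+≤ (ℤ.≤-<-trans (swap-lower c q) (ℤ.<-≤-trans inv (not-raised down))))
      where
      cancel : ∀ q → q - 1ℤ + 1ℤ ≡ q
      cancel = solve-∀

  translate-difference : ∀ {a b} c q q′ → a ≡ c + q * + n → b ≡ c + q′ * + n → b ≡ a + (q′ - q) * + n
  translate-difference c q q′ refl refl = eq c q q′ (+ n)
    where
    eq : ∀ c q q′ N → c + q′ * N ≡ c + q * N + (q′ - q) * N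
    eq = solve-∀

  translate-reflects : ∀ f {a b} m → f ⟨$⟩ b ≡ f ⟨$⟩ a + m * + n → b ≡ a + m * + n
  translate-reflects f {a} m eq = ⟨$⟩-injective f (trans eq (sym (⟨$⟩-shift f a m)))

  -- The first coordinates lie in [n], which has one point per class, so they force the shifts m and
  -- m′ to agree. The second coordinates may leave [n] and are compared only through this common
  -- shift.
  translates-unique : ∀ f m m′ {c c′ d d′} → InRange c → InRange c′ →
    f ⟨$⟩ c + m * + n ≡ f ⟨$⟩ c′ + m′ * + n → f ⟨$⟩ d + m * + n ≡ f ⟨$⟩ d′ + m′ * + n → (c , d) ≡ (c′ , d′)
  translates-unique f m m′ {c} {c′} {d} {d′} c∈ c′∈ eq₁ eq₂ =
    cong₂ _,_ (mod-unique k c∈ c′∈ c≡) (trans (untranslate eq₂) (+0*n k≡0))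
    where
    k = m′ - m
    untranslate : ∀ {c c′} → f ⟨$⟩ c + m * + n ≡ f ⟨$⟩ c′ + m′ * + n → c ≡ c′ + k * + n
    untranslate {c} {c′} eq = translate-reflects f k (trans (shift-sub m (sym eq)) (collect (f ⟨$⟩ c′) m m′ (+ n)))
      where
      collect : ∀ a m m′ N → a + m′ * N + - m * N ≡ a + (m′ - m) * N
      collect = solve-∀
    c≡ : c ≡ c′ + k * + n
    c≡ = untranslate eq₁
    k≡0 : k ≡ 0ℤ
    k≡0 = range-unique k c′∈ (subst InRange c≡ c∈)

  reflection-involutive : ∀ t → Reflection t → ∀ a → t ⟨$⟩ (t ⟨$⟩ a) ≡ a
  reflection-involutive t (g , i , _ , t≈) a = begin
    t ⟨$⟩ (t ⟨$⟩ a)                                                ≡⟨ cong (t ⟨$⟩_) (t≈ a) ⟩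
    t ⟨$⟩ ((g ⁻¹) ⟨$⟩ (s i ⟨$⟩ (g ⟨$⟩ a)))                           ≡⟨ t≈ _ ⟩
    (g ⁻¹) ⟨$⟩ (s i ⟨$⟩ (g ⟨$⟩ ((g ⁻¹) ⟨$⟩ (s i ⟨$⟩ (g ⟨$⟩ a)))))     ≡⟨ cong (λ b → (g ⁻¹) ⟨$⟩ (s i ⟨$⟩ b)) (⁻¹-cancelʳ g _) ⟩
    (g ⁻¹) ⟨$⟩ (s i ⟨$⟩ (s i ⟨$⟩ (g ⟨$⟩ a)))                         ≡⟨ cong ((g ⁻¹) ⟨$⟩_) (swap-involutive (+ toℕ i) _) ⟩
    (g ⁻¹) ⟨$⟩ (g ⟨$⟩ a)                                           ≡⟨ ⁻¹-cancelˡ g a ⟩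
    a                                                             ∎
    where open ≡-Reasoning

  -- The points moved by t form two classes modulo n, the preimages under g of the classes of c and
  -- c + 1, and t exchanges them. When one is raised, the other is lowered by the same amount.
  raised-translates : ∀ t → Reflection t → ∀ {a b} → a < t ⟨$⟩ a → b < t ⟨$⟩ b → ∃ λ m → b ≡ a + m * + n
  raised-translates t R@(g , i , _ , t≈) {a} {b} a< b< = go (swap-view c (g ⟨$⟩ a)) (swap-view c (g ⟨$⟩ b))
    where
    c = + toℕ i

    g∘t : ∀ a → g ⟨$⟩ (t ⟨$⟩ a) ≡ swap c (g ⟨$⟩ a)
    g∘t a = trans (cong (g ⟨$⟩_) (t≈ a)) (⁻¹-cancelʳ g _)

    not-fixed : ∀ {a} → a < t ⟨$⟩ a → ¬ (swap c (g ⟨$⟩ a) ≡ g ⟨$⟩ a)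
    not-fixed a< eq = ℤ.<-irrefl (⟨$⟩-injective g (sym (trans (g∘t _) eq))) a<

    not-both : ∀ {a b} q q′ → a < t ⟨$⟩ a → b < t ⟨$⟩ b →
               g ⟨$⟩ a ≡ c + q * + n → g ⟨$⟩ b ≡ c + 1ℤ + q′ * + n → swap c (g ⟨$⟩ b) ≡ g ⟨$⟩ b - 1ℤ → ⊥
    not-both {a} {b} q q′ a< b< eqa eqb sb = ℤ.<-asym b< (subst₂ _<_ (sym tb) (sym b≡) (ℤ.+-monoˡ-< (m * + n) a<))
      where
      m = q′ - q
      eq : ∀ c N → c + 1ℤ + N - 1ℤ ≡ c + N
      eq = solve-∀
      tb : t ⟨$⟩ b ≡ a + m * + n
      tb = translate-reflects g m (translate-difference c q q′ eqa
             (trans (g∘t b) (trans sb (trans (cong (_- 1ℤ) eqb) (eq c (q′ * + n))))))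
      b≡ : b ≡ t ⟨$⟩ a + m * + n
      b≡ = trans (sym (reflection-involutive t R b)) (trans (cong (t ⟨$⟩_) tb) (⟨$⟩-shift t a m))

    go : _ → _ → ∃ λ m → b ≡ a + m * + n
    go (inj₁ (q , eq , _)) (inj₁ (q′ , eq′ , _)) = q′ - q , translate-reflects g (q′ - q) (translate-difference c q q′ eq eq′)
    go (inj₂ (inj₁ (q , eq , _))) (inj₂ (inj₁ (q′ , eq′ , _))) = q′ - q , translate-reflects g (q′ - q) (translate-difference (c + 1ℤ) q q′ eq eq′)
    go (inj₁ (q , eq , _)) (inj₂ (inj₁ (q′ , eq′ , sb))) = ⊥-elim (not-both q q′ a< b< eq eq′ sb)
    go (inj₂ (inj₁ (q , eq , sa))) (inj₁ (q′ , eq′ , _)) = ⊥-elim (not-both q′ q b< a< eq′ eq sa)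
    go (inj₂ (inj₂ fix)) _ = ⊥-elim (not-fixed a< fix)
    go _ (inj₂ (inj₂ fix)) = ⊥-elim (not-fixed b< fix)

  raised-isometric : ∀ t → Reflection t → ∀ {a b} → a < t ⟨$⟩ a → b < t ⟨$⟩ b → a < b → t ⟨$⟩ a < t ⟨$⟩ b
  raised-isometric t R {a} {b} a< b< a<b with raised-translates t R a< b<
  ... | m , refl rewrite ⟨$⟩-shift t a m = <-from a<b (eq a (t ⟨$⟩ a) (m * + n))
    where
    eq : ∀ a b m → a + m - a ≡ b + m - b
    eq = solve-∀

  -- An inversion (c , d) of u ∙ t is either one of u, or is carried to one of u by the
  -- reflection T = u ∙ t ∙ u ⁻¹ acting on positions.
  descending-reflection : ∀ u t → Reflection t →
    (∀ a → a < t ⟨$⟩ a → (u ⁻¹) ⟨$⟩ (t ⟨$⟩ a) < (u ⁻¹) ⟨$⟩ a) → ℓ (u ∙ t) ℕ.≤ ℓ u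
  descending-reflection u t R desc = card-≤ (hasLength-ℓ (u ∙ t)) (hasLength-ℓ u) (λ x → proj₁ (φ x)) φ-injective
    where
    T : S̃
    T = u ∙ t ∙ u ⁻¹

    u∘T : ∀ c → u ⟨$⟩ (T ⟨$⟩ c) ≡ t ⟨$⟩ (u ⟨$⟩ c)
    u∘T c = ⁻¹-cancelʳ u _

    T-lowers : ∀ c → ¬ (t ⟨$⟩ (u ⟨$⟩ c) < u ⟨$⟩ c) → T ⟨$⟩ c ≤ c
    T-lowers c ≮ with ℤ.<-cmp (u ⟨$⟩ c) (t ⟨$⟩ (u ⟨$⟩ c))
    ... | tri< lt _ _ = ℤ.<⇒≤ (subst (T ⟨$⟩ c <_) (⁻¹-cancelˡ u c) (desc _ lt))
    ... | tri≈ _ eq _ = ℤ.≤-reflexive (trans (cong ((u ⁻¹) ⟨$⟩_) (sym eq)) (⁻¹-cancelˡ u c))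
    ... | tri> _ _ gt = ⊥-elim (≮ gt)

    lowered⇒raised : ∀ {a} → t ⟨$⟩ a < a → t ⟨$⟩ a < t ⟨$⟩ (t ⟨$⟩ a)
    lowered⇒raised {a} = subst (t ⟨$⟩ a <_) (sym (reflection-involutive t R a))

    -- A lowered value is the image of a raised one because t is an involution; `desc` is applied to
    -- that raised partner.
    T-raises : ∀ d → ¬ (u ⟨$⟩ d < t ⟨$⟩ (u ⟨$⟩ d)) → d ≤ T ⟨$⟩ d
    T-raises d ≮ with ℤ.<-cmp (u ⟨$⟩ d) (t ⟨$⟩ (u ⟨$⟩ d))
    ... | tri< lt _ _ = ⊥-elim (≮ lt)
    ... | tri≈ _ eq _ = ℤ.≤-reflexive (sym (trans (cong ((u ⁻¹) ⟨$⟩_) (sym eq)) (⁻¹-cancelˡ u d)))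
    ... | tri> _ _ gt = ℤ.<⇒≤ (subst (_< T ⟨$⟩ d)
      (trans (cong ((u ⁻¹) ⟨$⟩_) (reflection-involutive t R (u ⟨$⟩ d))) (⁻¹-cancelˡ u d)) (desc _ (lowered⇒raised gt)))

    -- t reverses u(c) < u(d). If u(c) were lowered, u(d) would be lowered as well; if u(d) were
    -- raised, so would u(c) be. Points moved in the same direction keep their order, so neither
    -- happens, and T(c) ≤ c < d ≤ T(d).
    T-inversion : ∀ {c d} → c < d → t ⟨$⟩ (u ⟨$⟩ d) < t ⟨$⟩ (u ⟨$⟩ c) → u ⟨$⟩ c < u ⟨$⟩ d →
                  T ⟨$⟩ c < T ⟨$⟩ d × u ⟨$⟩ (T ⟨$⟩ d) < u ⟨$⟩ (T ⟨$⟩ c)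
    T-inversion {c} {d} c<d inv uc<ud =
      ℤ.≤-<-trans (T-lowers c c-not-lowered) (ℤ.<-≤-trans c<d (T-raises d d-not-raised)) ,
      subst₂ _<_ (sym (u∘T d)) (sym (u∘T c)) inv
      where
      c-not-lowered : ¬ (t ⟨$⟩ (u ⟨$⟩ c) < u ⟨$⟩ c)
      c-not-lowered lt = ℤ.<-asym uc<ud (subst₂ _<_ (reflection-involutive t R _) (reflection-involutive t R _)
        (raised-isometric t R (lowered⇒raised (ℤ.<-trans inv (ℤ.<-trans lt uc<ud))) (lowered⇒raised lt) inv))

      d-not-raised : ¬ (u ⟨$⟩ d < t ⟨$⟩ (u ⟨$⟩ d))
      d-not-raised lt = ℤ.<-asym inv (raised-isometric t R (ℤ.<-trans uc<ud (ℤ.<-trans lt inv)) lt uc<ud)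

    -- `φ` returns evidence of how each image arose, so injectivity splits into cases on this
    -- evidence.
    Kept Moved : Inversion (u ∙ t) → Inversion u → Set
    Kept  x y = proj₁ y ≡ proj₁ x
    Moved ((c , d) , _) y = u ⟨$⟩ c < u ⟨$⟩ d × ∃ λ m → proj₁ y ≡ (T ⟨$⟩ c + m * + n , T ⟨$⟩ d + m * + n)

    φ : ∀ x → Σ (Inversion u) λ y → Kept x y ⊎ Moved x y
    φ ((c , d) , 1≤c , c≤n , c<d , inv) with u ⟨$⟩ d ℤ.<? u ⟨$⟩ c
    ... | yes lt = ((c , d) , 1≤c , c≤n , c<d , lt) , inj₁ refl
    ... | no ≮ = proj₁ (proj₂ moved) , inj₂ (uc<ud , proj₁ moved , proj₂ (proj₂ moved))
      where
      uc<ud = ≢∧≮⇒> (λ eq → ℤ.<-irrefl (sym (⟨$⟩-injective u eq)) c<d) ≮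
      T-inv = T-inversion c<d inv uc<ud
      moved = normalise u (proj₁ T-inv) (proj₂ T-inv)

    -- A kept pair is inverted by `u ∙ t`. A moved pair is not: since t is an involution, `u ∙ t`
    -- sends it to a translate of (u(c′), u(d′)), which is in increasing order.
    kept-moved : ∀ x x′ y → Kept x y → Moved x′ y → ⊥
    kept-moved ((c , d) , _ , _ , _ , inv) ((c′ , d′) , _) _ refl (uc′<ud′ , m , refl) =
      ℤ.<-asym inv (subst₂ _<_ (sym (undo c′)) (sym (undo d′)) (ℤ.+-monoˡ-< (m * + n) uc′<ud′))
      where
      undo : ∀ c → t ⟨$⟩ (u ⟨$⟩ (T ⟨$⟩ c + m * + n)) ≡ u ⟨$⟩ c + m * + n
      undo c = trans (⟨$⟩-shift (u ∙ t) (T ⟨$⟩ c) m)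
        (cong (_+ m * + n) (trans (cong (t ⟨$⟩_) (u∘T c)) (reflection-involutive t R _)))

    moved-moved : ∀ x x′ y → Moved x y → Moved x′ y → proj₁ x ≡ proj₁ x′
    moved-moved ((c , d) , 1≤c , c≤n , _) ((c′ , d′) , 1≤c′ , c′≤n , _) _ (_ , m , refl) (_ , m′ , eq) =
      translates-unique T m m′ (1≤c , c≤n) (1≤c′ , c′≤n) (cong proj₁ eq) (cong proj₂ eq)

    φ-injective : Injective _≡_ _≡_ (λ x → proj₁ (φ x))
    φ-injective {x} {x′} eq with φ x | φ x′
    φ-injective {x} {x′} refl | y , inj₁ k | _ , inj₁ k′ = inversion-≡ (u ∙ t) (trans (sym k) k′)
    φ-injective {x} {x′} refl | y , inj₁ k | _ , inj₂ m′ = ⊥-elim (kept-moved x x′ y k m′)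
    φ-injective {x} {x′} refl | y , inj₂ m | _ , inj₁ k′ = ⊥-elim (kept-moved x′ x y k′ m)
    φ-injective {x} {x′} refl | y , inj₂ m | _ , inj₂ m′ = inversion-≡ (u ∙ t) (moved-moved x x′ y m m′)

  -- If the inequality fails at one raised point, periodicity spreads the failure to all raised
  -- points, which are its translates; `descending-reflection` then contradicts the growth in
  -- length.
  ascending-reflection : ∀ u t → Reflection t → ℓ u ℕ.< ℓ (u ∙ t) →
    ∀ a → a < t ⟨$⟩ a → (u ⁻¹) ⟨$⟩ a < (u ⁻¹) ⟨$⟩ (t ⟨$⟩ a)
  ascending-reflection u t R longer a a<ta with (u ⁻¹) ⟨$⟩ a ℤ.<? (u ⁻¹) ⟨$⟩ (t ⟨$⟩ a)
  ... | yes lt = lt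
  ... | no ≮ = contradiction longer (ℕ.≤⇒≯ (descending-reflection u t R desc))
    where
    desc : ∀ b → b < t ⟨$⟩ b → (u ⁻¹) ⟨$⟩ (t ⟨$⟩ b) < (u ⁻¹) ⟨$⟩ b
    desc b b<tb with raised-translates t R a<ta b<tb
    ... | m , refl rewrite ⟨$⟩-shift t a m | ⟨$⟩-shift (u ⁻¹) a m | ⟨$⟩-shift (u ⁻¹) (t ⟨$⟩ a) m =
      ℤ.+-monoˡ-< (m * + n) (≢∧≮⇒> (λ eq → ℤ.<-irrefl (⟨$⟩-injective (u ⁻¹) eq) a<ta) ≮)

  -- Bruhat order

  ≤ᴮ⇒≈⊎ℓ< : ∀ {u v} → u ≤ᴮ v → u ≈ v ⊎ ℓ u ℕ.< ℓ v
  ≤ᴮ⇒≈⊎ℓ< (stop u≈v) = inj₁ u≈v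
  ≤ᴮ⇒≈⊎ℓ< {u} {v} (step {u′} _ _ u<u′ u′≤v) with ≤ᴮ⇒≈⊎ℓ< u′≤v
  ... | inj₁ u′≈v = inj₂ (ℕ.<-≤-trans (ℓ<⇒ {u} {u′} u<u′) (ℕ.≤-reflexive (ℓ-cong {u′} {v} u′≈v)))
  ... | inj₂ u′<v = inj₂ (ℕ.<-trans (ℓ<⇒ {u} {u′} u<u′) u′<v)

  step-raises : ∀ u u′ t → Reflection t → u′ ≈ u ∙ t → u ℓ< u′ →
    ∀ a → a < t ⟨$⟩ a → (u ⁻¹) ⟨$⟩ a < (u ⁻¹) ⟨$⟩ (t ⟨$⟩ a)
  step-raises u u′ t R u′≈ u<u′ = ascending-reflection u t R (subst (ℓ u ℕ.<_) (ℓ-cong {u′} {u ∙ t} u′≈) (ℓ<⇒ {u} {u′} u<u′))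

  -- A step exchanges values and moves the larger one to the left. If it lowers the value at a, the
  -- old value u(a) reappears in u′ at an earlier position a′, which is the new witness.
  ≤ᴮ-preserves-≥ : ∀ {u v} → u ≤ᴮ v → ∀ {i j} →
    (∃ λ a → a ≤ i × j ≤ u ⟨$⟩ a) → ∃ λ a → a ≤ i × j ≤ v ⟨$⟩ a
  ≤ᴮ-preserves-≥ (stop u≈v) {j = j} (a , a≤i , j≤) = a , a≤i , subst (j ≤_) (u≈v a) j≤
  ≤ᴮ-preserves-≥ {u} (step {u′} {t} R u′≈ u<u′ u′≤v) {i} {j} (a , a≤i , j≤) = ≤ᴮ-preserves-≥ u′≤v next
    where
    next : ∃ λ a → a ≤ i × j ≤ u′ ⟨$⟩ a
    next with t ⟨$⟩ (u ⟨$⟩ a) ℤ.<? u ⟨$⟩ a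
    ... | no ≮ = a , a≤i , ℤ.≤-trans j≤ (ℤ.≤-trans (ℤ.≮⇒≥ ≮) (ℤ.≤-reflexive (sym (u′≈ a))))
    ... | yes lt = a′ , ℤ.≤-trans (ℤ.<⇒≤ a′<a) a≤i , subst (j ≤_) (sym u′a′) j≤
      where
      b = t ⟨$⟩ (u ⟨$⟩ a)
      a′ = (u ⁻¹) ⟨$⟩ b
      tb : t ⟨$⟩ b ≡ u ⟨$⟩ a
      tb = reflection-involutive t R _
      a′<a : a′ < a
      a′<a = subst (a′ <_) (trans (cong ((u ⁻¹) ⟨$⟩_) tb) (⁻¹-cancelˡ u a))
        (step-raises u u′ t R u′≈ u<u′ b (subst (b <_) (sym tb) lt))
      u′a′ : u′ ⟨$⟩ a′ ≡ u ⟨$⟩ a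
      u′a′ = trans (u′≈ a′) (trans (cong (t ⟨$⟩_) (⁻¹-cancelʳ u b)) tb)

  ≤ᴮ-preserves-≤ : ∀ {u v} → u ≤ᴮ v → ∀ {i j} →
    (∃ λ a → i ≤ a × u ⟨$⟩ a ≤ j) → ∃ λ a → i ≤ a × v ⟨$⟩ a ≤ j
  ≤ᴮ-preserves-≤ (stop u≈v) {j = j} (a , i≤a , ≤j) = a , i≤a , subst (_≤ j) (u≈v a) ≤j
  ≤ᴮ-preserves-≤ {u} (step {u′} {t} R u′≈ u<u′ u′≤v) {i} {j} (a , i≤a , ≤j) = ≤ᴮ-preserves-≤ u′≤v next
    where
    next : ∃ λ a → i ≤ a × u′ ⟨$⟩ a ≤ j
    next with u ⟨$⟩ a ℤ.<? t ⟨$⟩ (u ⟨$⟩ a)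
    ... | no ≮ = a , i≤a , ℤ.≤-trans (ℤ.≤-reflexive (u′≈ a)) (ℤ.≤-trans (ℤ.≮⇒≥ ≮) ≤j)
    ... | yes lt = a′ , ℤ.≤-trans i≤a (ℤ.<⇒≤ a<a′) , subst (_≤ j) (sym u′a′) ≤j
      where
      b = t ⟨$⟩ (u ⟨$⟩ a)
      a′ = (u ⁻¹) ⟨$⟩ b
      a<a′ : a < a′
      a<a′ = subst (_< a′) (⁻¹-cancelˡ u a) (step-raises u u′ t R u′≈ u<u′ (u ⟨$⟩ a) lt)
      u′a′ : u′ ⟨$⟩ a′ ≡ u ⟨$⟩ a
      u′a′ = trans (u′≈ a′) (trans (cong (t ⟨$⟩_) (⁻¹-cancelʳ u b)) (reflection-involutive t R _))

  -- Simple reflections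

  simple-reflection : ∀ i → Reflection (s i)
  simple-reflection i = e , i , trans (sum-cong-≗ {n} (λ j → ℤ.+-inverseʳ (pos j))) (sum-replicate-zero n) , λ _ → refl

  -- A right ascent. Products are read left to right, so `f ∙ s i` exchanges the values i and i + 1,
  -- and f⁻¹ gives their positions.
  Ascent : S̃ → Fin n → Set
  Ascent f i = (f ⁻¹) ⟨$⟩ (+ toℕ i) < (f ⁻¹) ⟨$⟩ (+ toℕ i + 1ℤ)

  ascent-resp : ∀ {f g} i → f ≈ g → Ascent f i → Ascent g i
  ascent-resp {f} {g} i f≈g = subst₂ _<_ (⁻¹-cong {f} {g} f≈g _) (⁻¹-cong {f} {g} f≈g _)

  -- Equality is impossible because `s i` moves c; otherwise the length grows, and
  -- `ascending-reflection` applies at the raised point c.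
  ≤ᴮ⇒ascent : ∀ f i → f ≤ᴮ f ∙ s i → Ascent f i
  ≤ᴮ⇒ascent f i f≤ with ≤ᴮ⇒≈⊎ℓ< f≤
  ... | inj₁ f≈ = contradiction (trans (sym (⁻¹-cancelʳ f c)) (trans (f≈ _) (trans (cong (swap c) (⁻¹-cancelʳ f c)) (swap-base c))))
                    (ℤ.<⇒≢ (1+≤⇒< ℤ.≤-refl))
    where c = + toℕ i
  ... | inj₂ f< = subst (λ b → (f ⁻¹) ⟨$⟩ c < (f ⁻¹) ⟨$⟩ b) (swap-base c)
                    (ascending-reflection f (s i) (simple-reflection i) f< c (subst (c <_) (sym (swap-base c)) (1+≤⇒< ℤ.≤-refl)))
    where c = + toℕ i

  suc-card : ∀ {A : Set} {p} → Fin p ↔ A → Fin (suc p) ↔ (⊤ ⊎ A)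
  suc-card p↔ = (Fin.1↔⊤ ⊎-↔ p↔) ↔-∘ Fin.+↔⊎

  -- By `swap-inverts` a new inversion takes values c + mn and c + 1 + mn. Such pairs are translates
  -- of one another, so only one has its first entry in [n].
  ℓ-∙s-≤ : ∀ f i → ℓ (f ∙ s i) ℕ.≤ suc (ℓ f)
  ℓ-∙s-≤ f i = card-≤ (hasLength-ℓ (f ∙ s i)) (suc-card (hasLength-ℓ f)) (λ x → proj₁ (φ x)) φ-injective
    where
    c = + toℕ i

    Kept New : Inversion (f ∙ s i) → ⊤ ⊎ Inversion f → Set
    Kept x y = ∃ λ z → y ≡ inj₂ z × proj₁ z ≡ proj₁ x
    New ((a , b) , _) y = y ≡ inj₁ tt × ∃ λ m → f ⟨$⟩ a ≡ c + m * + n × f ⟨$⟩ b ≡ f ⟨$⟩ a + 1ℤ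

    φ : ∀ x → Σ (⊤ ⊎ Inversion f) λ y → Kept x y ⊎ New x y
    φ ((a , b) , 1≤a , a≤n , a<b , inv) with f ⟨$⟩ b ℤ.<? f ⟨$⟩ a
    ... | yes lt = inj₂ z , inj₁ (z , refl , refl)
      where z = (a , b) , 1≤a , a≤n , a<b , lt
    ... | no ≮ = inj₁ tt , inj₂ (refl , swap-inverts c (≢∧≮⇒> (λ eq → ℤ.<-irrefl (sym (⟨$⟩-injective f eq)) a<b) ≮) inv)

    new-new : ∀ x x′ y → New x y → New x′ y → proj₁ x ≡ proj₁ x′
    new-new ((a , b) , 1≤a , a≤n , _) ((a′ , b′) , 1≤a′ , a′≤n , _) _ (_ , m , fa≡ , fb≡) (_ , m′ , fa′≡ , fb′≡) =
      cong₂ _,_ a≡a′ (⟨$⟩-injective f (trans fb≡ (trans (cong (λ a → f ⟨$⟩ a + 1ℤ) a≡a′) (sym fb′≡))))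
      where
      a≡a′ = mod-unique (m - m′) (1≤a , a≤n) (1≤a′ , a′≤n)
        (translate-reflects f (m - m′) (translate-difference c m′ m fa′≡ fa≡))

    φ-injective : Injective _≡_ _≡_ (λ x → proj₁ (φ x))
    φ-injective {x} {x′} eq with φ x | φ x′
    φ-injective {x} {x′} refl | _ , inj₁ (_ , refl , k) | _ , inj₁ (_ , refl , k′) = inversion-≡ (f ∙ s i) (trans (sym k) k′)
    φ-injective {x} {x′} refl | _ , inj₁ (_ , refl , _) | _ , inj₂ (() , _)
    φ-injective {x} {x′} refl | _ , inj₂ (refl , _) | _ , inj₁ (_ , () , _)
    φ-injective {x} {x′} refl | y , inj₂ new | _ , inj₂ new′ = inversion-≡ (f ∙ s i) (new-new x x′ y new new′)

  -- Every inversion of f survives: `s i` could only restore the order of values c + mn and c + 1 +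
  -- mn, which at an ascent already stand in order. The translate of (A, B) is therefore not an
  -- inversion of f, and it is the additional one.
  ascent⇒ℓ< : ∀ f i → Ascent f i → ℓ f ℕ.< ℓ (f ∙ s i)
  ascent⇒ℓ< f i asc = card-≤ (suc-card (hasLength-ℓ f)) (hasLength-ℓ (f ∙ s i)) φ (λ {x} {y} → φ-injective {x} {y})
    where
    c = + toℕ i
    A = (f ⁻¹) ⟨$⟩ c
    B = (f ⁻¹) ⟨$⟩ (c + 1ℤ)

    swap-top : swap c (c + 1ℤ) ≡ c
    swap-top = trans (cong (swap c) (sym (swap-base c))) (swap-involutive c c)

    new = normalise (f ∙ s i) asc (subst₂ _<_
      (sym (trans (cong (swap c) (⁻¹-cancelʳ f (c + 1ℤ))) swap-top))
      (sym (trans (cong (swap c) (⁻¹-cancelʳ f c)) (swap-base c)))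
      (1+≤⇒< ℤ.≤-refl))

    kept : ∀ {a b} → a < b → f ⟨$⟩ b < f ⟨$⟩ a → swap c (f ⟨$⟩ b) < swap c (f ⟨$⟩ a)
    kept {a} {b} a<b fb<fa with swap c (f ⟨$⟩ b) ℤ.<? swap c (f ⟨$⟩ a)
    ... | yes lt = lt
    ... | no ≮ with swap-inverts c fb<fa (≢∧≮⇒> (λ eq → ℤ.<-irrefl (sym (⟨$⟩-injective (f ∙ s i) eq)) a<b) ≮)
    ...   | m , fb≡ , fa≡ = contradiction a<b (ℤ.<-asym (subst₂ _<_ (sym b≡) (sym a≡) (ℤ.+-monoˡ-< (m * + n) asc)))
      where
      comm : ∀ c m → c + m + 1ℤ ≡ c + 1ℤ + m
      comm = solve-∀
      b≡ : b ≡ A + m * + n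
      b≡ = translate-reflects f m (trans fb≡ (cong (_+ m * + n) (sym (⁻¹-cancelʳ f c))))
      a≡ : a ≡ B + m * + n
      a≡ = translate-reflects f m (trans fa≡ (trans (cong (_+ 1ℤ) fb≡)
        (trans (comm c (m * + n)) (cong (_+ m * + n) (sym (⁻¹-cancelʳ f (c + 1ℤ)))))))

    φ : ⊤ ⊎ Inversion f → Inversion (f ∙ s i)
    φ (inj₁ _) = proj₁ (proj₂ new)
    φ (inj₂ (ab , 1≤a , a≤n , a<b , inv)) = ab , 1≤a , a≤n , a<b , kept a<b inv

    new-not-kept : ∀ x → proj₁ (proj₁ (proj₂ new)) ≡ proj₁ x → ⊥
    new-not-kept (_ , _ , _ , _ , inv) eq with trans (sym (proj₂ (proj₂ new))) eq
    ... | refl = ℤ.<-asym inv (subst₂ _<_ (f-shift A≡) (f-shift B≡) (ℤ.+-monoˡ-< (m * + n) (1+≤⇒< {c} ℤ.≤-refl)))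
      where
      m = proj₁ new
      A≡ = ⁻¹-cancelʳ f c
      B≡ = ⁻¹-cancelʳ f (c + 1ℤ)
      f-shift : ∀ {a b} → f ⟨$⟩ a ≡ b → b + m * + n ≡ f ⟨$⟩ (a + m * + n)
      f-shift {a} refl = sym (⟨$⟩-shift f a m)

    φ-injective : Injective _≡_ _≡_ φ
    φ-injective {inj₁ _} {inj₁ _} _  = refl
    φ-injective {inj₁ _} {inj₂ y} eq = ⊥-elim (new-not-kept y (cong proj₁ eq))
    φ-injective {inj₂ x} {inj₁ _} eq = ⊥-elim (new-not-kept x (cong proj₁ (sym eq)))
    φ-injective {inj₂ x} {inj₂ y} eq = cong inj₂ (inversion-≡ f {x} {y} (cong proj₁ eq))

  ascent⇒≤ᴮ : ∀ f i → Ascent f i → f ≤ᴮ f ∙ s i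
  ascent⇒≤ᴮ f i asc = step {t = s i} (simple-reflection i) (λ _ → refl) (⇒ℓ< {f} {f ∙ s i} (ascent⇒ℓ< f i asc)) (stop {f ∙ s i} λ _ → refl)

  -- The parabolic subgroup Sₙ and its minimal left coset representatives

  Sn-∙ : ∀ {f g} → InSn f → InSn g → InSn (f ∙ g)
  Sn-∙ f∈ g∈ a 1≤a a≤n = let (1≤fa , fa≤n) = f∈ a 1≤a a≤n in g∈ _ 1≤fa fa≤n

  -- Write b = r + qn with r in [n]. Then f(b) = f(r) + qn, and both f(r) and f(b) = a lie in [n],
  -- so q = 0.
  Sn-⁻¹ : ∀ {f} → InSn f → InSn (f ⁻¹)
  Sn-⁻¹ {f} f∈ a 1≤a a≤n = subst InRange (trans (sym (+0*n q≡0)) (sym (pos∘res b))) (pos-range (res b))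
    where
    b = (f ⁻¹) ⟨$⟩ a
    q≡0 : quot b ≡ 0ℤ
    q≡0 = range-unique (quot b) (f∈ _ (proj₁ (pos-range (res b))) (proj₂ (pos-range (res b))))
      (subst InRange (trans (sym (⁻¹-cancelʳ f a)) (trans (cong (f ⟨$⟩_) (pos∘res b)) (⟨$⟩-shift f _ (quot b)))) (1≤a , a≤n))

  Sn-s : ∀ i → 1 ℕ.≤ toℕ i → InSn (s i)
  Sn-s i 1≤i a 1≤a a≤n with swap-view c a
    where c = + toℕ i
  ... | inj₁ (q , a≡ , eq) = subst InRange (sym eq) (subst (λ b → InRange (b + 1ℤ)) (sym (mod-unique q (1≤a , a≤n) c∈ a≡)) c+1∈)
    where
    c∈ : InRange (+ toℕ i)
    c∈ = +≤+ 1≤i , +≤+ (ℕ.<⇒≤ (Fin.toℕ<n i))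
    c+1∈ : InRange (+ toℕ i + 1ℤ)
    c+1∈ = subst InRange (ℤ.+-comm 1ℤ (+ toℕ i)) (pos-range i)
  ... | inj₂ (inj₁ (q , a≡ , eq)) = subst InRange (sym (trans eq (trans (cong (_- 1ℤ) (mod-unique q (1≤a , a≤n) c+1∈ a≡)) (cancel (+ toℕ i))))) c∈
    where
    cancel : ∀ c → c + 1ℤ - 1ℤ ≡ c
    cancel = solve-∀
    c∈ : InRange (+ toℕ i)
    c∈ = +≤+ 1≤i , +≤+ (ℕ.<⇒≤ (Fin.toℕ<n i))
    c+1∈ : InRange (+ toℕ i + 1ℤ)
    c+1∈ = subst InRange (ℤ.+-comm 1ℤ (+ toℕ i)) (pos-range i)
  ... | inj₂ (inj₂ eq) = subst InRange (sym eq) (1≤a , a≤n)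

  Sn-decompose : ∀ {g} → InSn g → ∀ b → g ⟨$⟩ b ≡ g ⟨$⟩ pos (res b) + quot b * + n × InRange (g ⟨$⟩ pos (res b))
  Sn-decompose {g} g∈ b =
    trans (cong (g ⟨$⟩_) (pos∘res b)) (⟨$⟩-shift g _ (quot b)) ,
    g∈ _ (proj₁ (pos-range (res b))) (proj₂ (pos-range (res b)))

  Sn-reflects-≤n : ∀ {g} → InSn g → ∀ {b} → g ⟨$⟩ b ≤ + n → b ≤ + n
  Sn-reflects-≤n {g} g∈ {b} gb≤n = begin
    b                            ≡⟨ pos∘res b ⟩
    pos (res b) + quot b * + n   ≤⟨ ℤ.+-mono-≤ (proj₂ (pos-range (res b))) (ℤ.*-monoʳ-≤-nonNeg (+ n) q≤0) ⟩
    + n + 0ℤ                     ≡⟨ ℤ.+-identityʳ (+ n) ⟩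
    + n                          ∎
    where
    open ℤ.≤-Reasoning
    q≤0 : quot b ≤ 0ℤ
    q≤0 = let (gb≡ , 1≤ , _) = Sn-decompose {g} g∈ b in block-≤ (quot b) 1≤ (subst (_≤ + n) gb≡ gb≤n)

  Sn-reflects-1≤ : ∀ {g} → InSn g → ∀ {b} → 1ℤ ≤ g ⟨$⟩ b → 1ℤ ≤ b
  Sn-reflects-1≤ {g} g∈ {b} 1≤gb = begin
    1ℤ + 0ℤ                      ≤⟨ ℤ.+-mono-≤ (proj₁ (pos-range (res b))) (ℤ.*-monoʳ-≤-nonNeg (+ n) 0≤q) ⟩
    pos (res b) + quot b * + n   ≡⟨ pos∘res b ⟨
    b                            ∎
    where
    open ℤ.≤-Reasoning
    0≤q : 0ℤ ≤ quot b
    0≤q = let (gb≡ , _ , ≤n) = Sn-decompose {g} g∈ b in block-≥ (quot b) ≤n (subst (1ℤ ≤_) gb≡ 1≤gb)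

  -- After a shift of p into [n], the inverted partner has a value below g(p) ≤ n, and g keeps
  -- points beyond n beyond n. So g inverts only pairs inside one block of length n.
  Sn-inverts : ∀ {g} → InSn g → ∀ {p q} → p < q → g ⟨$⟩ q < g ⟨$⟩ p → ∃ λ m → 1ℤ ≤ p + m * + n × q + m * + n ≤ + n
  Sn-inverts {g} g∈ {p} {q} p<q inv with to-range p
  ... | m , 1≤p′ , p′≤n = m , 1≤p′ , Sn-reflects-≤n {g} g∈
    (ℤ.≤-trans (ℤ.<⇒≤ (subst₂ _<_ (sym (⟨$⟩-shift g q m)) (sym (⟨$⟩-shift g p m)) (ℤ.+-monoˡ-< (m * + n) inv)))
      (proj₂ (g∈ _ 1≤p′ p′≤n)))

  -- Equivalently, the values in each block of length n occur in X in increasing order from left to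
  -- right.
  MinimalRep : S̃ → Set
  MinimalRep X = ∀ {c d} → 1ℤ ≤ c → c < d → d ≤ + n → (X ⁻¹) ⟨$⟩ c < (X ⁻¹) ⟨$⟩ d

  -- g can restore the order of X(b) < X(a) only if both values lie in one block, but there X⁻¹ is
  -- increasing, which would give b < a.
  minimalRep-⊆ : ∀ {X g} → MinimalRep X → InSn g →
    ∀ {a b} → a < b → X ⟨$⟩ b < X ⟨$⟩ a → g ⟨$⟩ (X ⟨$⟩ b) < g ⟨$⟩ (X ⟨$⟩ a)
  minimalRep-⊆ {X} {g} X-min g∈ {a} {b} a<b inv with g ⟨$⟩ (X ⟨$⟩ b) ℤ.<? g ⟨$⟩ (X ⟨$⟩ a)
  ... | yes lt = lt
  ... | no ≮ with Sn-inverts {g} g∈ inv (≢∧≮⇒> (λ eq → ℤ.<-irrefl (sym (⟨$⟩-injective (X ∙ g) eq)) a<b) ≮)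
  ...   | m , 1≤ , ≤n = contradiction (+-unshift-< (m * + n) (subst₂ _<_ (back b) (back a) (X-min 1≤ (ℤ.+-monoˡ-< (m * + n) inv) ≤n))) (ℤ.<-asym a<b)
    where
    back : ∀ a → (X ⁻¹) ⟨$⟩ (X ⟨$⟩ a + m * + n) ≡ a + m * + n
    back a = trans (⟨$⟩-shift (X ⁻¹) _ m) (cong (_+ m * + n) (⁻¹-cancelˡ X a))

  module _ {X h : S̃} (X-min : MinimalRep X) (h∈ : InSn h) (i : Fin n) (1≤i : 1 ℕ.≤ toℕ i) where

    private
      h⁻¹∈ = Sn-⁻¹ {h} h∈
      c∈ = h⁻¹∈ (+ toℕ i) (+≤+ 1≤i) (+≤+ (ℕ.<⇒≤ (Fin.toℕ<n i)))
      -- `pos i` is i + 1, because `s` is indexed from 0 and `pos` starts at 1.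
      c+1∈ = subst (λ b → InRange ((h ⁻¹) ⟨$⟩ b)) (ℤ.+-comm 1ℤ (+ toℕ i)) (h⁻¹∈ (pos i) (proj₁ (pos-range i)) (proj₂ (pos-range i)))

    ascent-∙ˡ : Ascent h i → Ascent (X ∙ h) i
    ascent-∙ˡ asc = X-min (proj₁ c∈) asc (proj₂ c+1∈)

    ascent-∙ˡ⁻¹ : Ascent (X ∙ h) i → Ascent h i
    ascent-∙ˡ⁻¹ asc with (h ⁻¹) ⟨$⟩ (+ toℕ i) ℤ.<? (h ⁻¹) ⟨$⟩ (+ toℕ i + 1ℤ)
    ... | yes lt = lt
    ... | no ≮ = contradiction asc (ℤ.<-asym (X-min (proj₁ c+1∈)
      (≢∧≮⇒> (λ eq → ℤ.<⇒≢ (1+≤⇒< ℤ.≤-refl) (⟨$⟩-injective (h ⁻¹) eq)) ≮) (proj₂ c∈)))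

  -- Distinguished subwords

  -- Also applied with both equivalences trivial: differently bracketed products agree pointwise by
  -- computation but are different records.
  ≤ᴮ-resp-≈ : ∀ {u u′ v v′} → u ≈ u′ → v ≈ v′ → u ≤ᴮ v → u′ ≤ᴮ v′
  ≤ᴮ-resp-≈ u≈ v≈ (stop u≈v) = stop λ a → trans (sym (u≈ a)) (trans (u≈v a) (v≈ a))
  ≤ᴮ-resp-≈ {u} {u′} u≈ v≈ (step {u₁} {t} R u₁≈ u<u₁ u₁≤v) = step {t = t} R
    (λ a → trans (u₁≈ a) (cong (t ⟨$⟩_) (u≈ a)))
    (⇒ℓ< {u′} {u₁} (subst (ℕ._< ℓ u₁) (ℓ-cong {u} {u′} u≈) (ℓ<⇒ {u} {u₁} u<u₁)))
    (≤ᴮ-resp-≈ {u₁} {u₁} (λ _ → refl) v≈ u₁≤v)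

  -- Distinguished subwords with h multiplied to the left of all partial products: a letter
  -- may always be selected, and may be skipped exactly at an ascent.
  data DistinguishedFrom (h : S̃) : Word → List Entry → Set where
    []     : DistinguishedFrom h [] []
    select : ∀ {i 𝐠 𝐮} → DistinguishedFrom (h ∙ s i) 𝐠 𝐮 → DistinguishedFrom h (i ∷ 𝐠) (just i ∷ 𝐮)
    skip   : ∀ {i 𝐠 𝐮} → Ascent h i → DistinguishedFrom h 𝐠 𝐮 → DistinguishedFrom h (i ∷ 𝐠) (nothing ∷ 𝐮)

  toDistinguishedFrom : ∀ h {𝐠 𝐮} → IsSubword 𝐠 𝐮 →
    (∀ j → h ∙ 𝐮 ₍ suc (toℕ j) ₎ ≤ᴮ h ∙ 𝐮 ₍ toℕ j ₎ ∙ s (lookup 𝐠 j)) → DistinguishedFrom h 𝐠 𝐮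
  toDistinguishedFrom h [] _ = []
  toDistinguishedFrom h {i ∷ _} (inj₁ refl ∷ sub) dist =
    select (toDistinguishedFrom (h ∙ s i) sub λ j → ≤ᴮ-resp-≈ (λ _ → refl) (λ _ → refl) (dist (suc j)))
  toDistinguishedFrom h {i ∷ _} (inj₂ refl ∷ sub) dist = skip
    (≤ᴮ⇒ascent h i (≤ᴮ-resp-≈ (λ _ → refl) (λ _ → refl) (dist zero)))
    (toDistinguishedFrom h sub λ j → ≤ᴮ-resp-≈ (λ _ → refl) (λ _ → refl) (dist (suc j)))

  fromDistinguishedFrom : ∀ h {𝐠 𝐮} → DistinguishedFrom h 𝐠 𝐮 →
    ∀ j → h ∙ 𝐮 ₍ suc (toℕ j) ₎ ≤ᴮ h ∙ 𝐮 ₍ toℕ j ₎ ∙ s (lookup 𝐠 j)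
  fromDistinguishedFrom h (select _) zero = stop λ _ → refl
  -- For a selected letter the two sides of the condition coincide.
  fromDistinguishedFrom h (skip {i} asc _) zero = ≤ᴮ-resp-≈ (λ _ → refl) (λ _ → refl) (ascent⇒≤ᴮ h i asc)
  fromDistinguishedFrom h (select {i} dist) (suc j) =
    ≤ᴮ-resp-≈ (λ _ → refl) (λ _ → refl) (fromDistinguishedFrom (h ∙ s i) dist j)
  fromDistinguishedFrom h (skip _ dist) (suc j) =
    ≤ᴮ-resp-≈ (λ _ → refl) (λ _ → refl) (fromDistinguishedFrom h dist j)

  toDistinguishedFrom-e : ∀ {𝐠 𝐮} → IsSubword 𝐠 𝐮 → Distinguished 𝐠 𝐮 → DistinguishedFrom e 𝐠 𝐮
  toDistinguishedFrom-e sub dist = toDistinguishedFrom e sub λ j → ≤ᴮ-resp-≈ (λ _ → refl) (λ _ → refl) (dist j)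

  fromDistinguishedFrom-e : ∀ {𝐠 𝐮} → DistinguishedFrom e 𝐠 𝐮 → Distinguished 𝐠 𝐮
  fromDistinguishedFrom-e dist j = ≤ᴮ-resp-≈ (λ _ → refl) (λ _ → refl) (fromDistinguishedFrom e dist j)

  distinguishedFrom-resp : ∀ h h′ {𝐠 𝐮} → h ≈ h′ → DistinguishedFrom h 𝐠 𝐮 → DistinguishedFrom h′ 𝐠 𝐮
  distinguishedFrom-resp h h′ h≈ [] = []
  distinguishedFrom-resp h h′ h≈ (select {i} dist) =
    select (distinguishedFrom-resp (h ∙ s i) (h′ ∙ s i) (λ a → cong (s i ⟨$⟩_) (h≈ a)) dist)
  distinguishedFrom-resp h h′ h≈ (skip {i} asc dist) =
    skip (ascent-resp {h} {h′} i h≈ asc) (distinguishedFrom-resp h h′ h≈ dist)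

  prepend-distinguished : ∀ h 𝐱 {𝐠 𝐮} → DistinguishedFrom (h ∙ word 𝐱) 𝐠 𝐮 → DistinguishedFrom h (𝐱 ++ 𝐠) (map just 𝐱 ++ 𝐮)
  prepend-distinguished h [] = distinguishedFrom-resp (h ∙ e) h λ _ → refl
  prepend-distinguished h (i ∷ 𝐱) dist = select (prepend-distinguished (h ∙ s i) 𝐱
    (distinguishedFrom-resp (h ∙ word (i ∷ 𝐱)) (h ∙ s i ∙ word 𝐱) (λ _ → refl) dist))

  unprepend-distinguished : ∀ h 𝐱 {𝐠 𝐮} → DistinguishedFrom h (𝐱 ++ 𝐠) (map just 𝐱 ++ 𝐮) → DistinguishedFrom (h ∙ word 𝐱) 𝐠 𝐮
  unprepend-distinguished h [] = distinguishedFrom-resp h (h ∙ e) λ _ → refl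
  unprepend-distinguished h (i ∷ 𝐱) (select dist) =
    distinguishedFrom-resp (h ∙ s i ∙ word 𝐱) (h ∙ word (i ∷ 𝐱)) (λ _ → refl) (unprepend-distinguished (h ∙ s i) 𝐱 dist)

  module _ {X : S̃} (X-min : MinimalRep X) where

    distinguished-∙ˡ : ∀ h {𝐠 𝐮} → InSn h → All (λ i → 1 ℕ.≤ toℕ i) 𝐠 → DistinguishedFrom h 𝐠 𝐮 → DistinguishedFrom (X ∙ h) 𝐠 𝐮
    distinguished-∙ˡ h h∈ [] [] = []
    distinguished-∙ˡ h h∈ (1≤i ∷ 1≤) (select {i} dist) = select (distinguishedFrom-resp (X ∙ (h ∙ s i)) (X ∙ h ∙ s i) (λ _ → refl)
      (distinguished-∙ˡ (h ∙ s i) (Sn-∙ {h} {s i} h∈ (Sn-s i 1≤i)) 1≤ dist))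
    distinguished-∙ˡ h h∈ (1≤i ∷ 1≤) (skip {i} asc dist) =
      skip (ascent-∙ˡ {X} {h} X-min h∈ i 1≤i asc) (distinguished-∙ˡ h h∈ 1≤ dist)

    distinguished-∙ˡ⁻¹ : ∀ h {𝐠 𝐮} → InSn h → All (λ i → 1 ℕ.≤ toℕ i) 𝐠 → DistinguishedFrom (X ∙ h) 𝐠 𝐮 → DistinguishedFrom h 𝐠 𝐮
    distinguished-∙ˡ⁻¹ h h∈ [] [] = []
    distinguished-∙ˡ⁻¹ h h∈ (1≤i ∷ 1≤) (select {i} dist) = select (distinguished-∙ˡ⁻¹ (h ∙ s i) (Sn-∙ {h} {s i} h∈ (Sn-s i 1≤i)) 1≤
      (distinguishedFrom-resp (X ∙ h ∙ s i) (X ∙ (h ∙ s i)) (λ _ → refl) dist))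
    distinguished-∙ˡ⁻¹ h h∈ (1≤i ∷ 1≤) (skip {i} asc dist) =
      skip (ascent-∙ˡ⁻¹ {X} {h} X-min h∈ i 1≤i asc) (distinguished-∙ˡ⁻¹ h h∈ 1≤ dist)

  -- Products of subwords

  product-++ : ∀ 𝐮 𝐯 → product (𝐮 ++ 𝐯) ≈ product 𝐮 ∙ product 𝐯
  product-++ []      𝐯 a = refl
  product-++ (u ∷ 𝐮) 𝐯 a = product-++ 𝐮 𝐯 (entry u ⟨$⟩ a)

  product-just : ∀ 𝐱 → product (map just 𝐱) ≈ word 𝐱
  product-just []      a = refl
  product-just (i ∷ 𝐱) a = product-just 𝐱 (s i ⟨$⟩ a)

  word-++ : ∀ 𝐱 𝐰 → word (𝐱 ++ 𝐰) ≈ word 𝐱 ∙ word 𝐰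
  word-++ []      𝐰 a = refl
  word-++ (i ∷ 𝐱) 𝐰 a = word-++ 𝐱 𝐰 (s i ⟨$⟩ a)

  take-subword : ∀ {𝐠 𝐮} → IsSubword 𝐠 𝐮 → take (length 𝐠) 𝐮 ≡ 𝐮
  take-subword [] = refl
  take-subword {_} {u ∷ _} (_ ∷ sub) = cong (u ∷_) (take-subword sub)

  product-take : ∀ {𝐠 𝐮} → IsSubword 𝐠 𝐮 → 𝐮 ₍ length 𝐠 ₎ ≈ product 𝐮
  product-take sub a = cong (λ 𝐮 → product 𝐮 ⟨$⟩ a) (take-subword sub)

  just-subword : ∀ 𝐱 {𝐰 𝐮} → IsSubword 𝐰 𝐮 → IsSubword (𝐱 ++ 𝐰) (map just 𝐱 ++ 𝐮)
  just-subword []      sub = sub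
  just-subword (_ ∷ 𝐱) sub = inj₁ refl ∷ just-subword 𝐱 sub

  split-subword : ∀ 𝐱 {𝐰 𝐲} → IsSubword (𝐱 ++ 𝐰) 𝐲 → ∃₂ λ 𝐲₁ 𝐲₂ → 𝐲 ≡ 𝐲₁ ++ 𝐲₂ × IsSubword 𝐱 𝐲₁ × IsSubword 𝐰 𝐲₂
  split-subword [] sub = [] , _ , refl , [] , sub
  split-subword (_ ∷ 𝐱) (u ∷ sub) with split-subword 𝐱 sub
  ... | 𝐲₁ , 𝐲₂ , refl , sub₁ , sub₂ = _ ∷ 𝐲₁ , 𝐲₂ , refl , u ∷ sub₁ , sub₂

  #e-just : ∀ 𝐱 𝐮 → #e (map just 𝐱 ++ 𝐮) ≡ #e 𝐮
  #e-just []      𝐮 = refl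
  #e-just (_ ∷ 𝐱) 𝐮 = #e-just 𝐱 𝐮

  product∈Sn : ∀ {𝐰 𝐮} → All (λ i → 1 ℕ.≤ toℕ i) 𝐰 → IsSubword 𝐰 𝐮 → InSn (product 𝐮)
  product∈Sn [] [] a 1≤a a≤n = 1≤a , a≤n
  product∈Sn {i ∷ _} {_ ∷ 𝐮} (1≤i ∷ 1≤) (inj₁ refl ∷ sub) = Sn-∙ {s i} {product 𝐮} (Sn-s i 1≤i) (product∈Sn 1≤ sub)
  product∈Sn (_ ∷ 1≤) (inj₂ refl ∷ sub) = product∈Sn 1≤ sub

  selected : List Entry → ℕ
  selected 𝐮 = length (catMaybes 𝐮)

  ℓ-product : ∀ g 𝐮 → ℓ (g ∙ product 𝐮) ℕ.≤ selected 𝐮 ℕ.+ ℓ g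
  ℓ-product g []            = ℕ.≤-reflexive (ℓ-cong {g ∙ e} {g} λ _ → refl)
  ℓ-product g (nothing ∷ 𝐮) = subst (ℕ._≤ selected 𝐮 ℕ.+ ℓ g) (ℓ-cong {g ∙ product 𝐮} {g ∙ product (nothing ∷ 𝐮)} λ _ → refl) (ℓ-product g 𝐮)
  ℓ-product g (just i ∷ 𝐮)  = begin
    ℓ (g ∙ product (just i ∷ 𝐮))   ≡⟨ ℓ-cong {g ∙ product (just i ∷ 𝐮)} {g ∙ s i ∙ product 𝐮} (λ _ → refl) ⟩
    ℓ (g ∙ s i ∙ product 𝐮)        ≤⟨ ℓ-product (g ∙ s i) 𝐮 ⟩
    selected 𝐮 ℕ.+ ℓ (g ∙ s i)     ≤⟨ ℕ.+-monoʳ-≤ (selected 𝐮) (ℓ-∙s-≤ g i) ⟩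
    selected 𝐮 ℕ.+ suc (ℓ g)       ≡⟨ ℕ.+-suc (selected 𝐮) (ℓ g) ⟩
    suc (selected 𝐮 ℕ.+ ℓ g)       ∎
    where open ℕ.≤-Reasoning

  ℓ-Λ : ∀ c → ℓ (Λ^ c) ≡ 0
  ℓ-Λ c = ℕ.n≤0⇒n≡0 (card-≤ (hasLength-ℓ (Λ^ c)) Fin.0↔⊥ none λ {x} _ → ⊥-elim (none x))
    where
    none : Inversion (Λ^ c) → ⊥
    none (_ , _ , _ , a<b , inv) = ℤ.<-asym a<b (+-unshift-< c inv)

  ℓ-Λ∙product : ∀ c 𝐮 → ℓ (Λ^ c ∙ product 𝐮) ℕ.≤ selected 𝐮
  ℓ-Λ∙product c 𝐮 = subst (ℓ (Λ^ c ∙ product 𝐮) ℕ.≤_) (trans (cong (selected 𝐮 ℕ.+_) (ℓ-Λ c)) (ℕ.+-identityʳ _)) (ℓ-product (Λ^ c) 𝐮)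

  selected-≤ : ∀ {𝐱 𝐮} → IsSubword 𝐱 𝐮 → selected 𝐮 ℕ.≤ length 𝐱
  selected-≤ [] = ℕ.z≤n
  selected-≤ (inj₁ refl ∷ sub) = ℕ.s≤s (selected-≤ sub)
  selected-≤ (inj₂ refl ∷ sub) = ℕ.m≤n⇒m≤1+n (selected-≤ sub)

  all-selected : ∀ {𝐱 𝐮} → IsSubword 𝐱 𝐮 → length 𝐱 ℕ.≤ selected 𝐮 → 𝐮 ≡ map just 𝐱
  all-selected [] _ = refl
  all-selected {i ∷ _} (inj₁ refl ∷ sub) (ℕ.s≤s le) = cong (just i ∷_) (all-selected sub le)
  all-selected (inj₂ refl ∷ sub) le = contradiction (selected-≤ sub) (ℕ.<⇒≱ le)

  -- The prepending bijection

  module _ {x v : S̃} {k : ℕ} {𝐱 𝐰 : Word} (x-min : MinimalRep x) (v∈ : InSn v)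
           (x-reduced : IsReducedWord k x 𝐱) (1≤𝐰 : All (λ i → 1 ℕ.≤ toℕ i) 𝐰) where

    private
      word𝐱≈ : word 𝐱 ≈ Λ^ (- + k) ∙ x
      word𝐱≈ = proj₁ x-reduced

      -- In word 𝐱 = Λ⁻ᵏ x the factor Λ⁻ᵏ acts first, so the inverse is x⁻¹ followed by adding k,
      -- which preserves order.
      word-minimal : MinimalRep (word 𝐱)
      word-minimal 1≤c c<d d≤n = subst₂ _<_
        (sym (⁻¹-cong {word 𝐱} {Λ^ (- + k) ∙ x} word𝐱≈ _))
        (sym (⁻¹-cong {word 𝐱} {Λ^ (- + k) ∙ x} word𝐱≈ _))
        (ℤ.+-monoˡ-< (- - + k) (x-min 1≤c c<d d≤n))

      id∈ : InSn e
      id∈ _ 1≤a a≤n = 1≤a , a≤n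

      product-prepend : ∀ 𝐮 → product (map just 𝐱 ++ 𝐮) ≈ Λ^ (- + k) ∙ x ∙ product 𝐮
      product-prepend 𝐮 a = trans (product-++ (map just 𝐱) 𝐮 a) (cong (product 𝐮 ⟨$⟩_) (trans (product-just 𝐱 a) (word𝐱≈ a)))

      -- The partial product over 𝐱 lies in the coset of x, so its length is at least ℓ x = length 𝐱.
      coset-selects-all : ∀ {𝐲 𝐮} → IsSubword 𝐱 𝐲 → IsSubword 𝐰 𝐮 → product (𝐲 ++ 𝐮) ≈ Λ^ (- + k) ∙ (x ∙ v) → 𝐲 ≡ map just 𝐱
      coset-selects-all {𝐲} {𝐮} sub-𝐲 sub-𝐮 prod = all-selected sub-𝐲 (begin
        length 𝐱                      ≡⟨ hasLength⇒≡ℓ x (proj₂ x-reduced) ⟩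
        ℓ x                           ≤⟨ ℓ-mono-⊆ x (x ∙ g) (minimalRep-⊆ {x} {g} x-min g∈) ⟩
        ℓ (x ∙ g)                     ≡⟨ ℓ-cong {x ∙ g} {Λ^ (+ k) ∙ product 𝐲} x∙g≈ ⟩
        ℓ (Λ^ (+ k) ∙ product 𝐲)      ≤⟨ ℓ-Λ∙product (+ k) 𝐲 ⟩
        selected 𝐲                    ∎)
        where
        open ℕ.≤-Reasoning
        -- Cancelling `product 𝐮` on the right of `prod` leaves x g = Λᵏ · product 𝐲, with g in Sₙ.
        g : S̃
        g = v ∙ product 𝐮 ⁻¹
        g∈ : InSn g
        g∈ = Sn-∙ {v} {product 𝐮 ⁻¹} v∈ (Sn-⁻¹ {product 𝐮} (product∈Sn 1≤𝐰 sub-𝐮))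
        cancel : ∀ a k → a ≡ a + k + - k
        cancel = solve-∀
        x∙g≈ : x ∙ g ≈ Λ^ (+ k) ∙ product 𝐲
        x∙g≈ a = ⟨$⟩-injective (product 𝐮) (trans (⁻¹-cancelʳ (product 𝐮) _)
          (trans (cong (λ b → v ⟨$⟩ (x ⟨$⟩ b)) (cancel a (+ k))) (trans (sym (prod (a + + k))) (product-++ 𝐲 𝐮 (a + + k)))))

    prepend-bijective : ∀ r → BijectiveOn (𝓓 r v 𝐰) (𝓐 k r (x ∙ v) (𝐱 ++ 𝐰)) (map just 𝐱 ++_)
    prepend-bijective r = forward , (λ _ _ → ++-cancelˡ (map just 𝐱) _ _) , λ y → backward y (split-subword 𝐱 (proj₁ y))
      where
      X : S̃
      X = Λ^ (- + k) ∙ x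

      forward : ∀ {𝐮} → 𝓓 r v 𝐰 𝐮 → 𝓐 k r (x ∙ v) (𝐱 ++ 𝐰) (map just 𝐱 ++ 𝐮)
      forward {𝐮} (sub , dist , prod , #e≡r) = sub′ , dist′ , prod′ , trans (#e-just 𝐱 𝐮) #e≡r
        where
        sub′ : IsSubword (𝐱 ++ 𝐰) (map just 𝐱 ++ 𝐮)
        sub′ = just-subword 𝐱 sub
        dist′ : Distinguished (𝐱 ++ 𝐰) (map just 𝐱 ++ 𝐮)
        dist′ = fromDistinguishedFrom-e (prepend-distinguished e 𝐱
          (distinguishedFrom-resp (word 𝐱 ∙ e) (e ∙ word 𝐱) (λ _ → refl)
            (distinguished-∙ˡ {word 𝐱} word-minimal e id∈ 1≤𝐰 (toDistinguishedFrom-e sub dist))))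
        prod′ : (map just 𝐱 ++ 𝐮) ₍ length (𝐱 ++ 𝐰) ₎ ≈ Λ^ (- + k) ∙ (x ∙ v)
        prod′ a = trans (product-take sub′ a) (trans (product-prepend 𝐮 a)
          (trans (sym (product-take sub (X ⟨$⟩ a))) (prod (X ⟨$⟩ a))))

      backward : ∀ {𝐲} → 𝓐 k r (x ∙ v) (𝐱 ++ 𝐰) 𝐲 →
        (∃₂ λ 𝐲₁ 𝐲₂ → 𝐲 ≡ 𝐲₁ ++ 𝐲₂ × IsSubword 𝐱 𝐲₁ × IsSubword 𝐰 𝐲₂) → ∃ λ 𝐮 → 𝓓 r v 𝐰 𝐮 × map just 𝐱 ++ 𝐮 ≡ 𝐲
      backward {𝐲} (sub , dist , prod , #e≡r) (𝐲₁ , 𝐮 , 𝐲≡ , sub₁ , sub₂) =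
        𝐮 , (sub₂ , dist′ , prod′ , trans (sym (#e-just 𝐱 𝐮)) (trans (cong #e 𝐱𝐮≡𝐲) #e≡r)) , 𝐱𝐮≡𝐲
        where
        product-𝐲 : product 𝐲 ≈ Λ^ (- + k) ∙ (x ∙ v)
        product-𝐲 a = trans (sym (product-take sub a)) (prod a)
        𝐲₁≡ : 𝐲₁ ≡ map just 𝐱
        𝐲₁≡ = coset-selects-all sub₁ sub₂ (subst (λ 𝐲 → product 𝐲 ≈ Λ^ (- + k) ∙ (x ∙ v)) 𝐲≡ product-𝐲)
        𝐱𝐮≡𝐲 : map just 𝐱 ++ 𝐮 ≡ 𝐲
        𝐱𝐮≡𝐲 = trans (cong (_++ 𝐮) (sym 𝐲₁≡)) (sym 𝐲≡)
        dist′ : Distinguished 𝐰 𝐮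
        dist′ = fromDistinguishedFrom-e (distinguished-∙ˡ⁻¹ {word 𝐱} word-minimal e id∈ 1≤𝐰
          (distinguishedFrom-resp (e ∙ word 𝐱) (word 𝐱 ∙ e) (λ _ → refl) (unprepend-distinguished e 𝐱
            (subst (DistinguishedFrom e (𝐱 ++ 𝐰)) (sym 𝐱𝐮≡𝐲) (toDistinguishedFrom-e sub dist)))))
        product-𝐮∘X : ∀ a → product 𝐮 ⟨$⟩ (X ⟨$⟩ a) ≡ v ⟨$⟩ (X ⟨$⟩ a)
        product-𝐮∘X a = trans (sym (product-prepend 𝐮 a)) (trans (cong (λ 𝐲 → product 𝐲 ⟨$⟩ a) 𝐱𝐮≡𝐲) (product-𝐲 a))
        prod′ : 𝐮 ₍ length 𝐰 ₎ ≈ v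
        prod′ a = trans (product-take sub₂ a) (subst (λ b → product 𝐮 ⟨$⟩ b ≡ v ⟨$⟩ b) (⁻¹-cancelʳ X a) (product-𝐮∘X ((X ⁻¹) ⟨$⟩ a)))

  -- Inversions of X stay inversions of `X ∙ g`. An inversion (c, d) of g lies in one block, so
  -- pulling it back along X⁻¹ keeps c before d and gives an inversion of `X ∙ g`. The two kinds are
  -- disjoint, since X inverts the first and not the second.
  ℓ-additive : ∀ {X g} → MinimalRep X → InSn g → ℓ X ℕ.+ ℓ g ℕ.≤ ℓ (X ∙ g)
  ℓ-additive {X} {g} X-min g∈ =
    card-≤ ((hasLength-ℓ X ⊎-↔ hasLength-ℓ g) ↔-∘ Fin.+↔⊎) (hasLength-ℓ (X ∙ g)) φ (λ {x} {y} → φ-injective {x} {y})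
    where
    pulled : (x : Inversion g) → let ((c , d) , _) = x in
      ∃ λ m → Σ (Inversion (X ∙ g)) λ y → proj₁ y ≡ ((X ⁻¹) ⟨$⟩ c + m * + n , (X ⁻¹) ⟨$⟩ d + m * + n)
    pulled ((c , d) , 1≤c , c≤n , c<d , inv) = normalise (X ∙ g)
      (X-min 1≤c c<d (Sn-reflects-≤n {g} g∈ (ℤ.≤-trans (ℤ.<⇒≤ inv) (proj₂ (g∈ c 1≤c c≤n)))))
      (subst₂ _<_ (cong (g ⟨$⟩_) (sym (⁻¹-cancelʳ X d))) (cong (g ⟨$⟩_) (sym (⁻¹-cancelʳ X c))) inv)

    φ : Inversion X ⊎ Inversion g → Inversion (X ∙ g)
    φ (inj₁ (ab , 1≤a , a≤n , a<b , inv)) = ab , 1≤a , a≤n , a<b , minimalRep-⊆ {X} {g} X-min g∈ a<b inv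
    φ (inj₂ x) = proj₁ (proj₂ (pulled x))

    disjoint : (x : Inversion X) (y : Inversion g) → proj₁ x ≡ proj₁ (φ (inj₂ y)) → ⊥
    disjoint (_ , _ , _ , _ , inv) y@((c , d) , _ , _ , c<d , _) eq with trans eq (proj₂ (proj₂ (pulled y)))
    ... | refl = ℤ.<-asym inv (subst₂ _<_ (back c) (back d) (ℤ.+-monoˡ-< (m * + n) c<d))
      where
      m = proj₁ (pulled y)
      back : ∀ c → c + m * + n ≡ X ⟨$⟩ ((X ⁻¹) ⟨$⟩ c + m * + n)
      back c = sym (trans (⟨$⟩-shift X _ m) (cong (_+ m * + n) (⁻¹-cancelʳ X c)))

    φ-injective : Injective _≡_ _≡_ φ
    φ-injective {inj₁ x} {inj₁ y} eq = cong inj₁ (inversion-≡ X {x} {y} (cong proj₁ eq))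
    φ-injective {inj₁ x} {inj₂ y} eq = ⊥-elim (disjoint x y (cong proj₁ eq))
    φ-injective {inj₂ x} {inj₁ y} eq = ⊥-elim (disjoint y x (cong proj₁ (sym eq)))
    φ-injective {inj₂ x@((c , d) , 1≤c , c≤n , _)} {inj₂ y@((c′ , d′) , 1≤c′ , c′≤n , _)} eq =
      cong inj₂ (inversion-≡ g {x} {y} (translates-unique (X ⁻¹) (proj₁ (pulled x)) (proj₁ (pulled y)) (1≤c , c≤n) (1≤c′ , c′≤n)
        (cong proj₁ pairs≡) (cong proj₂ pairs≡)))
      where
      pairs≡ = trans (sym (proj₂ (proj₂ (pulled x)))) (trans (cong proj₁ eq) (proj₂ (proj₂ (pulled y))))

  -- Translations

  ≈-on-range : ∀ f g → (∀ i → f ⟨$⟩ pos i ≡ g ⟨$⟩ pos i) → f ≈ g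
  ≈-on-range f g eq a = begin
    f ⟨$⟩ a                                ≡⟨ cong (f ⟨$⟩_) (pos∘res a) ⟩
    f ⟨$⟩ (pos (res a) + quot a * + n)     ≡⟨ ⟨$⟩-shift f _ (quot a) ⟩
    f ⟨$⟩ pos (res a) + quot a * + n       ≡⟨ cong (_+ quot a * + n) (eq (res a)) ⟩
    g ⟨$⟩ pos (res a) + quot a * + n       ≡⟨ ⟨$⟩-shift g _ (quot a) ⟨
    g ⟨$⟩ (pos (res a) + quot a * + n)     ≡⟨ cong (g ⟨$⟩_) (pos∘res a) ⟨
    g ⟨$⟩ a                                ∎
    where open ≡-Reasoning

  τ-raises : ∀ S a → Vec.lookup S (res a) ≡ true → τ S ⟨$⟩ a ≡ a + + n
  τ-raises S a eq rewrite eq = refl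

  τ-fixes : ∀ S a → Vec.lookup S (res a) ≡ false → τ S ⟨$⟩ a ≡ a
  τ-fixes S a eq rewrite eq = refl

  τₖ-raises : ∀ {k c} → InRange c → c ≤ + k → τₖ k ⟨$⟩ c ≡ c + + n
  τₖ-raises {k} {c} c∈ c≤k = τ-raises (Vec.tabulate λ i → does (toℕ i ℕ.<? k)) c
    (trans (lookup∘tabulate (λ i → does (toℕ i ℕ.<? k)) (res c)) (dec-true (toℕ (res c) ℕ.<? k) (ℤ.drop‿+≤+ c≤k′)))
    where
    c≤k′ : pos (res c) ≤ + k
    c≤k′ = subst (_≤ + k) (sym (pos∘res-range c∈)) c≤k

  τₖ-fixes : ∀ {k c} → InRange c → + k < c → τₖ k ⟨$⟩ c ≡ c
  τₖ-fixes {k} {c} c∈ k<c = τ-fixes (Vec.tabulate λ i → does (toℕ i ℕ.<? k)) c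
    (trans (lookup∘tabulate (λ i → does (toℕ i ℕ.<? k)) (res c)) (dec-false (toℕ (res c) ℕ.<? k)
      (λ lt → ℤ.<⇒≱ k<c (subst (_≤ + k) (pos∘res-range c∈) (+≤+ lt)))))

  ⟨$⟩-lower : ∀ f a → f ⟨$⟩ (a - + n) ≡ f ⟨$⟩ a - + n
  ⟨$⟩-lower f a = trans (cong (f ⟨$⟩_) (eq a (+ n))) (trans (⟨$⟩-shift f a (- 1ℤ)) (sym (eq (f ⟨$⟩ a) (+ n))))
    where
    eq : ∀ a N → a - N ≡ a + - 1ℤ * N
    eq = solve-∀

  -- Grassmannian permutations

  module _ {k : ℕ} {w : S̃} (w∈ : InSn w) (w-grass : Grassmannian k w) where

    x⁻¹-low : ∀ {c} → InRange c → c ≤ + k → (x k w ⁻¹) ⟨$⟩ c ≡ w ⟨$⟩ c - + n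
    x⁻¹-low {c} c∈ c≤k = trans (cong (w ⟨$⟩_) τ⁻¹c) (⟨$⟩-lower w c)
      where
      cancel : ∀ c N → c + N - N ≡ c
      cancel = solve-∀
      τ⁻¹c : (τₖ k ⁻¹) ⟨$⟩ c ≡ c - + n
      τ⁻¹c = ⟨$⟩-injective (τₖ k) (trans (⁻¹-cancelʳ (τₖ k) c)
        (sym (trans (⟨$⟩-lower (τₖ k) c) (trans (cong (_- + n) (τₖ-raises c∈ c≤k)) (cancel c (+ n))))))

    x⁻¹-high : ∀ {c} → InRange c → + k < c → (x k w ⁻¹) ⟨$⟩ c ≡ w ⟨$⟩ c
    x⁻¹-high {c} c∈ k<c = cong (w ⟨$⟩_) (⟨$⟩-injective (τₖ k) (trans (⁻¹-cancelʳ (τₖ k) c) (sym (τₖ-fixes c∈ k<c))))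

    -- x⁻¹(c) is w(c) - n ≤ 0 for c ≤ k and w(c) ≥ 1 for c > k; inside each range the Grassmannian
    -- condition applies.
    x-minimal : MinimalRep (x k w)
    x-minimal {c} {d} 1≤c c<d d≤n = cases (c ℤ.≤? + k) (d ℤ.≤? + k)
      where
      c∈ : InRange c
      c∈ = 1≤c , ℤ.≤-trans (ℤ.<⇒≤ c<d) d≤n
      d∈ : InRange d
      d∈ = ℤ.≤-trans 1≤c (ℤ.<⇒≤ c<d) , d≤n
      cases : Dec (c ≤ + k) → Dec (d ≤ + k) → (x k w ⁻¹) ⟨$⟩ c < (x k w ⁻¹) ⟨$⟩ d
      cases (yes c≤k) (yes d≤k) = subst₂ _<_ (sym (x⁻¹-low c∈ c≤k)) (sym (x⁻¹-low d∈ d≤k))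
        (ℤ.+-monoˡ-< (- + n) (proj₁ w-grass c d 1≤c c<d d≤k))
      cases (yes c≤k) (no d≰k) = subst₂ _<_ (sym (x⁻¹-low c∈ c≤k)) (sym (x⁻¹-high d∈ (ℤ.≰⇒> d≰k)))
        (ℤ.≤-<-trans (ℤ.i≤j⇒i-j≤0 (proj₂ (w∈ c (proj₁ c∈) (proj₂ c∈)))) (ℤ.suc[i]≤j⇒i<j (proj₁ (w∈ d (proj₁ d∈) (proj₂ d∈)))))
      cases (no c≰k) _ = subst₂ _<_ (sym (x⁻¹-high c∈ (ℤ.≰⇒> c≰k))) (sym (x⁻¹-high d∈ (ℤ.<-trans (ℤ.≰⇒> c≰k) c<d)))
        (proj₂ w-grass c d (ℤ.i<j⇒suc[i]≤j (ℤ.≰⇒> c≰k)) c<d d≤n)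

    w⁻¹-range : ∀ {a} → InRange a → InRange ((w ⁻¹) ⟨$⟩ a)
    w⁻¹-range (1≤a , a≤n) = Sn-⁻¹ {w} w∈ _ 1≤a a≤n

    image⁺ : ∀ {i} → (w ⁻¹) ⟨$⟩ pos i ≤ + k → Vec.lookup (image k w) i ≡ true
    image⁺ {i} b≤k = trans (lookup∘tabulate _ i) (dec-true (Fin.any? λ j → w ⟨$⟩ (+ suc (toℕ j)) ℤ.≟ pos i)
      (proj₁ preimage , trans (cong (w ⟨$⟩_) (proj₂ preimage)) (⁻¹-cancelʳ w (pos i))))
      where
      preimage = fromRange {k} (proj₁ (w⁻¹-range (pos-range i))) b≤k

    image⁻ : ∀ {i} → + k < (w ⁻¹) ⟨$⟩ pos i → Vec.lookup (image k w) i ≡ false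
    image⁻ {i} k<b = trans (lookup∘tabulate _ i) (dec-false (Fin.any? λ j → w ⟨$⟩ (+ suc (toℕ j)) ℤ.≟ pos i)
      λ (j , eq) → ℤ.<⇒≱ k<b (subst (_≤ + k) (trans (sym (⁻¹-cancelˡ w _)) (cong ((w ⁻¹) ⟨$⟩_) eq)) (+≤+ (Fin.toℕ<n j))))

    x∙-low : ∀ v {a} → InRange a → (w ⁻¹) ⟨$⟩ a ≤ + k → (x k w ∙ v) ⟨$⟩ a ≡ v ⟨$⟩ ((w ⁻¹) ⟨$⟩ a) + + n
    x∙-low v a∈ b≤k = trans (cong (v ⟨$⟩_) (τₖ-raises (w⁻¹-range a∈) b≤k)) (periodic v _)

    x∙-high : ∀ v {a} → InRange a → + k < (w ⁻¹) ⟨$⟩ a → (x k w ∙ v) ⟨$⟩ a ≡ v ⟨$⟩ ((w ⁻¹) ⟨$⟩ a)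
    x∙-high v a∈ k<b = cong (v ⟨$⟩_) (τₖ-fixes (w⁻¹-range a∈) k<b)

    res-pos : ∀ i → res (pos i) ≡ i
    res-pos i = pos-injective (pos∘res-range (pos-range i))

    -- x w is the conjugate w⁻¹ τₖ w, which raises exactly the classes of w([k]).
    τ-image : τ (image k w) ≈ x k w ∙ w
    τ-image = ≈-on-range (τ (image k w)) (x k w ∙ w) λ i → on-pos i ((w ⁻¹) ⟨$⟩ pos i ℤ.≤? + k)
      where
      on-pos : ∀ i → Dec ((w ⁻¹) ⟨$⟩ pos i ≤ + k) → τ (image k w) ⟨$⟩ pos i ≡ (x k w ∙ w) ⟨$⟩ pos i
      on-pos i (yes b≤k) = trans (τ-raises (image k w) (pos i) (trans (cong (Vec.lookup (image k w)) (res-pos i)) (image⁺ b≤k)))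
        (sym (trans (x∙-low w (pos-range i) b≤k) (cong (_+ + n) (⁻¹-cancelʳ w (pos i)))))
      on-pos i (no b≰k) = trans (τ-fixes (image k w) (pos i) (trans (cong (Vec.lookup (image k w)) (res-pos i)) (image⁻ (ℤ.≰⇒> b≰k))))
        (sym (trans (x∙-high w (pos-range i) (ℤ.≰⇒> b≰k)) (⁻¹-cancelʳ w (pos i))))

    -- The spelling by 𝐱𝐰 bounds the length of the translation from above; `ℓ-additive` bounds it
    -- from below.
    concatenation-reduced : ∀ 𝐱 𝐰 → IsReducedWord k (x k w) 𝐱 → IsReducedWordSn w 𝐰 →
      IsReducedWord k (τ (image k w)) (𝐱 ++ 𝐰)
    concatenation-reduced 𝐱 𝐰 (word𝐱≈ , x-length) (_ , word𝐰≈ , w-length) =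
      word≈ , subst (HasLength (τ (image k w))) ℓ≡ (hasLength-ℓ (τ (image k w)))
      where
      word≈ : word (𝐱 ++ 𝐰) ≈ Λ^ (- + k) ∙ τ (image k w)
      word≈ a = trans (word-++ 𝐱 𝐰 a) (trans (word𝐰≈ _) (trans (cong (w ⟨$⟩_) (word𝐱≈ a)) (sym (τ-image _))))

      τ≈ : τ (image k w) ≈ Λ^ (+ k) ∙ product (map just (𝐱 ++ 𝐰))
      τ≈ a = sym (trans (product-just (𝐱 ++ 𝐰) _) (trans (word≈ _) (cong (τ (image k w) ⟨$⟩_) (cancel a (+ k)))))
        where
        cancel : ∀ a k → a + k + - k ≡ a
        cancel = solve-∀

      upper : ℓ (τ (image k w)) ℕ.≤ length (𝐱 ++ 𝐰)
      upper = begin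
        ℓ (τ (image k w))                              ≡⟨ ℓ-cong {τ (image k w)} {Λ^ (+ k) ∙ product (map just (𝐱 ++ 𝐰))} τ≈ ⟩
        ℓ (Λ^ (+ k) ∙ product (map just (𝐱 ++ 𝐰)))     ≤⟨ ℓ-Λ∙product (+ k) (map just (𝐱 ++ 𝐰)) ⟩
        selected (map just (𝐱 ++ 𝐰))                   ≤⟨ selected-≤ (map-just-subword (𝐱 ++ 𝐰)) ⟩
        length (𝐱 ++ 𝐰)                                ∎
        where
        open ℕ.≤-Reasoning
        map-just-subword : ∀ 𝐠 → IsSubword 𝐠 (map just 𝐠)
        map-just-subword []      = []
        map-just-subword (_ ∷ 𝐠) = inj₁ refl ∷ map-just-subword 𝐠

      lower-bound : length (𝐱 ++ 𝐰) ℕ.≤ ℓ (τ (image k w))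
      lower-bound = begin
        length (𝐱 ++ 𝐰)              ≡⟨ length-++ 𝐱 ⟩
        length 𝐱 ℕ.+ length 𝐰        ≡⟨ cong₂ ℕ._+_ (hasLength⇒≡ℓ (x k w) x-length) (hasLength⇒≡ℓ w w-length) ⟩
        ℓ (x k w) ℕ.+ ℓ w            ≤⟨ ℓ-additive {x k w} {w} x-minimal w∈ ⟩
        ℓ (x k w ∙ w)                ≡⟨ ℓ-cong {τ (image k w)} {x k w ∙ w} τ-image ⟨
        ℓ (τ (image k w))            ∎
        where open ℕ.≤-Reasoning

      ℓ≡ : ℓ (τ (image k w)) ≡ length (𝐱 ++ 𝐰)
      ℓ≡ = ℕ.≤-antisym upper lower-bound

    -- Bounded affine permutations

    module _ {v : S̃} (v∈ : InSn v) where

      -- For a = r + qn with r in [n], f(a) is v(w⁻¹(r)) + qn, plus n if w⁻¹(r) ≤ k, and v(w⁻¹(r))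
      -- is in [n]. Having a < 1 ≤ f(a) thus forces q = -1 and w⁻¹(r) ≤ k, whence the witness
      -- `pos i - + n`.
      image≐I₁ : (_∈ image k w) ≐ I₁ (x k w ∙ v)
      image≐I₁ = image⊆I₁ , I₁⊆image
        where
        f = x k w ∙ v

        image⊆I₁ : ∀ {i} → i ∈ image k w → I₁ f i
        image⊆I₁ {i} i∈ with (w ⁻¹) ⟨$⟩ pos i ℤ.≤? + k
        ... | no b≰k with trans (sym ([]=⇒lookup i∈)) (image⁻ (ℤ.≰⇒> b≰k))
        ...   | ()
        image⊆I₁ {i} i∈ | yes b≤k = pos i - + n ,
          ℤ.≤-<-trans (ℤ.i≤j⇒i-j≤0 (proj₂ (pos-range i))) (+<+ ℕ.z<s) ,
          subst (1ℤ ≤_) (sym fa≡) (proj₁ (v∈ _ (proj₁ b∈) (proj₂ b∈))) ,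
          trans (res-lower (pos i)) (res-pos i)
          where
          b∈ = w⁻¹-range (pos-range i)
          cancel : ∀ c N → c + N - N ≡ c
          cancel = solve-∀
          fa≡ : f ⟨$⟩ (pos i - + n) ≡ v ⟨$⟩ ((w ⁻¹) ⟨$⟩ pos i)
          fa≡ = trans (⟨$⟩-lower f (pos i)) (trans (cong (_- + n) (x∙-low v (pos-range i) b≤k)) (cancel _ (+ n)))

        I₁⊆image : ∀ {i} → I₁ f i → i ∈ image k w
        I₁⊆image (a , a<1 , 1≤fa , refl) with (w ⁻¹) ⟨$⟩ pos (res a) ℤ.≤? + k
        ... | yes b≤k = lookup⇒[]= (res a) (image k w) (image⁺ b≤k)
        ... | no b≰k = contradiction (ℤ.<-≤-trans a<1 1≤a) (ℤ.<-irrefl refl)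
          where
          b∈ = w⁻¹-range (pos-range (res a))
          vb∈ = v∈ _ (proj₁ b∈) (proj₂ b∈)
          fa≡ : f ⟨$⟩ a ≡ v ⟨$⟩ ((w ⁻¹) ⟨$⟩ pos (res a)) + quot a * + n
          fa≡ = trans (cong (f ⟨$⟩_) (pos∘res a)) (trans (⟨$⟩-shift f _ (quot a))
            (cong (_+ quot a * + n) (x∙-high v (pos-range (res a)) (ℤ.≰⇒> b≰k))))
          0≤q : 0ℤ ≤ quot a
          0≤q = block-≥ (quot a) (proj₂ vb∈) (subst (1ℤ ≤_) fa≡ 1≤fa)
          1≤a : 1ℤ ≤ a
          1≤a = subst (1ℤ ≤_) (sym (pos∘res a)) (ℤ.+-mono-≤ (proj₁ (pos-range (res a))) (ℤ.*-monoʳ-≤-nonNeg (+ n) 0≤q))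

      module _ (v≤w : v ≤ᴮ w) where

        -- The chain gives some a ≤ b with w(a) ≥ v(b) ≥ 1, hence a ≥ 1; as w increases on [k], w(b)
        -- ≥ w(a).
        v≤w-low : ∀ {b} → InRange b → b ≤ + k → v ⟨$⟩ b ≤ w ⟨$⟩ b
        v≤w-low {b} b∈ b≤k with ≤ᴮ-preserves-≥ v≤w (b , ℤ.≤-refl , ℤ.≤-refl)
        ... | a , a≤b , vb≤wa with a ℤ.≟ b
        ...   | yes refl = vb≤wa
        ...   | no a≢b = ℤ.≤-trans vb≤wa (ℤ.<⇒≤ (proj₁ w-grass a b
          (Sn-reflects-1≤ {w} w∈ (ℤ.≤-trans (proj₁ (v∈ b (proj₁ b∈) (proj₂ b∈))) vb≤wa)) (ℤ.≤∧≢⇒< a≤b a≢b) b≤k))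

        w≤v-high : ∀ {b} → InRange b → + k < b → w ⟨$⟩ b ≤ v ⟨$⟩ b
        w≤v-high {b} b∈ k<b with ≤ᴮ-preserves-≤ v≤w (b , ℤ.≤-refl , ℤ.≤-refl)
        ... | a , b≤a , wa≤vb with b ℤ.≟ a
        ...   | yes refl = wa≤vb
        ...   | no b≢a = ℤ.≤-trans (ℤ.<⇒≤ (proj₂ w-grass b a (ℤ.i<j⇒suc[i]≤j k<b) (ℤ.≤∧≢⇒< b≤a b≢a)
          (Sn-reflects-≤n {w} w∈ (ℤ.≤-trans wa≤vb (proj₂ (v∈ b (proj₁ b∈) (proj₂ b∈))))))) wa≤vb

        -- With b = w⁻¹(a), f(a) is v(b) + n or v(b). Comparing v(b) with w(b) = a gives the upper
        -- bound in the first case and the lower bound in the second; the other bounds hold because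
        -- v(b) and a lie in [n].
        bounded-on-range : ∀ {a} → InRange a → a ≤ (x k w ∙ v) ⟨$⟩ a × (x k w ∙ v) ⟨$⟩ a ≤ a + + n
        bounded-on-range {a} a∈ = cases (b ℤ.≤? + k)
          where
          b = (w ⁻¹) ⟨$⟩ a
          b∈ : InRange b
          b∈ = w⁻¹-range a∈
          vb∈ : InRange (v ⟨$⟩ b)
          vb∈ = v∈ b (proj₁ b∈) (proj₂ b∈)
          n≤+n : ∀ {c} → InRange c → + n ≤ c + + n
          n≤+n {c} (1≤c , _) = subst (_≤ c + + n) (ℤ.+-identityˡ (+ n)) (ℤ.+-monoˡ-≤ (+ n) (ℤ.≤-trans (+≤+ ℕ.z≤n) 1≤c))
          cases : Dec (b ≤ + k) → a ≤ (x k w ∙ v) ⟨$⟩ a × (x k w ∙ v) ⟨$⟩ a ≤ a + + n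
          cases (yes b≤k) = subst (λ y → a ≤ y × y ≤ a + + n) (sym (x∙-low v a∈ b≤k))
            (ℤ.≤-trans (proj₂ a∈) (n≤+n vb∈) , ℤ.+-monoˡ-≤ (+ n) (subst (v ⟨$⟩ b ≤_) (⁻¹-cancelʳ w a) (v≤w-low b∈ b≤k)))
          cases (no b≰k) = subst (λ y → a ≤ y × y ≤ a + + n) (sym (x∙-high v a∈ (ℤ.≰⇒> b≰k)))
            (subst (_≤ v ⟨$⟩ b) (⁻¹-cancelʳ w a) (w≤v-high b∈ (ℤ.≰⇒> b≰k)) , ℤ.≤-trans (proj₂ vb∈) (n≤+n a∈))

        x∙v-bounded : ∀ a → a ≤ (x k w ∙ v) ⟨$⟩ a × (x k w ∙ v) ⟨$⟩ a ≤ a + + n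
        x∙v-bounded a =
          subst₂ _≤_ (sym (pos∘res a)) (sym fa≡) (ℤ.+-monoˡ-≤ (quot a * + n) (proj₁ bd)) ,
          subst₂ _≤_ (sym fa≡) (trans (comm (pos (res a)) (+ n) (quot a * + n)) (cong (_+ + n) (sym (pos∘res a))))
            (ℤ.+-monoˡ-≤ (quot a * + n) (proj₂ bd))
          where
          bd = bounded-on-range (pos-range (res a))
          comm : ∀ a N m → a + N + m ≡ a + m + N
          comm = solve-∀
          fa≡ : (x k w ∙ v) ⟨$⟩ a ≡ (x k w ∙ v) ⟨$⟩ pos (res a) + quot a * + n
          fa≡ = trans (cong ((x k w ∙ v) ⟨$⟩_) (pos∘res a)) (⟨$⟩-shift (x k w ∙ v) _ (quot a))

  -- Average displacement

  sum-Sn : ∀ {g} → InSn g → (h : ℤ → ℤ) → sum (λ i → h (g ⟨$⟩ pos i)) ≡ sum (λ i → h (pos i))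
  sum-Sn {g} g∈ h = sym (trans (sum-permute (h ∘ pos) π) (sum-cong-≗ λ i → cong h (pos∘res-range (range i))))
    where
    range : ∀ i → InRange (g ⟨$⟩ pos i)
    range i = g∈ _ (proj₁ (pos-range i)) (proj₂ (pos-range i))
    range⁻¹ : ∀ i → InRange ((g ⁻¹) ⟨$⟩ pos i)
    range⁻¹ i = Sn-⁻¹ {g} g∈ _ (proj₁ (pos-range i)) (proj₂ (pos-range i))
    π : Permutation n n
    π = mk↔ₛ′ (λ i → res (g ⟨$⟩ pos i)) (λ i → res ((g ⁻¹) ⟨$⟩ pos i))
      (λ i → pos-injective (trans (cong (λ b → pos (res (g ⟨$⟩ b))) (pos∘res-range (range⁻¹ i)))
        (trans (cong (pos ∘ res) (⁻¹-cancelʳ g (pos i))) (pos∘res-range (pos-range i)))))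
      (λ i → pos-injective (trans (cong (λ b → pos (res ((g ⁻¹) ⟨$⟩ b))) (pos∘res-range (range i)))
        (trans (cong (pos ∘ res) (⁻¹-cancelˡ g (pos i))) (pos∘res-range (pos-range i)))))

  -- Adding `sum pos` removes the subtraction. Then w⁻¹ and v only permute summands, and τₖ
  -- contributes n for each of the k raised indices.
  x∙v∈S̃ : ∀ {k v w} → k ℕ.≤ n → InSn v → InSn w → InS̃ k (x k w ∙ v)
  x∙v∈S̃ {k} {v} {w} k≤n v∈ w∈ = cancel (begin
    sum (λ i → f ⟨$⟩ pos i - pos i) + sum pos          ≡⟨ ∑-distrib-+ (λ i → f ⟨$⟩ pos i - pos i) pos ⟨
    sum (λ i → f ⟨$⟩ pos i - pos i + pos i)            ≡⟨ sum-cong-≗ (λ i → i-j+j≡i (f ⟨$⟩ pos i) (pos i)) ⟩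
    sum (λ i → f ⟨$⟩ pos i)                            ≡⟨ sum-Sn {w ⁻¹} (Sn-⁻¹ {w} w∈) ((τₖ k ∙ v) ⟨$⟩_) ⟩
    sum (λ i → (τₖ k ∙ v) ⟨$⟩ pos i)                   ≡⟨ sum-cong-≗ τₖ∙v ⟩
    sum (λ i → v ⟨$⟩ pos i + δ i)                      ≡⟨ ∑-distrib-+ (λ i → v ⟨$⟩ pos i) δ ⟩
    sum (λ i → v ⟨$⟩ pos i) + sum δ                    ≡⟨ cong₂ _+_ (sum-Sn {v} v∈ (λ a → a)) (sum-indicator k (+ n) k≤n) ⟩
    sum pos + + k * + n                                ∎)
    where
    open ≡-Reasoning
    f = x k w ∙ v
    δ : Fin n → ℤ
    δ i = if does (toℕ i ℕ.<? k) then + n else 0ℤ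

    i-j+j≡i : ∀ i j → i - j + j ≡ i
    i-j+j≡i = solve-∀

    cancel : ∀ {i j l} → i + j ≡ j + l → i ≡ l
    cancel {i} {j} {l} eq = trans (eq₁ i j) (trans (cong (_- j) eq) (eq₂ j l))
      where
      eq₁ : ∀ i j → i ≡ i + j - j
      eq₁ = solve-∀
      eq₂ : ∀ j l → j + l - j ≡ l
      eq₂ = solve-∀

    τₖ∙v : ∀ i → (τₖ k ∙ v) ⟨$⟩ pos i ≡ v ⟨$⟩ pos i + δ i
    τₖ∙v i = by-cases (toℕ i ℕ.<? k)
      where
      -- Generalised over the decision, so that matching on it also reduces the `if` coming from
      -- `δ`.
      by-cases : (i<?k : Dec (toℕ i ℕ.< k)) → (τₖ k ∙ v) ⟨$⟩ pos i ≡ v ⟨$⟩ pos i + (if does i<?k then + n else 0ℤ)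
      by-cases (yes i<k) = trans (cong (v ⟨$⟩_) (τₖ-raises (pos-range i) (+≤+ i<k))) (periodic v _)
      by-cases (no i≮k) = trans (cong (v ⟨$⟩_) (τₖ-fixes (pos-range i) (+<+ (ℕ.s≤s (ℕ.≮⇒≥ i≮k))))) (sym (ℤ.+-identityʳ _))

corollary3p12 : (n k : ℕ) (2≤n : 2 ℕ.≤ n) → k ℕ.≤ n →
    let open Affine n 2≤n in
    (v w : S̃) → InSn v → InSn w → v ≤ᴮ w → Grassmannian k w →
    (𝐱 𝐰 : Word) → IsReducedWord k (x k w) 𝐱 → IsReducedWordSn w 𝐰 →
    let f = w ⁻¹ ∙ τₖ k ∙ v in
    InB k f
    × IsReducedWord k (τ (P k w ᵁ)) (𝐱 ++ 𝐰)
    × (∀ r → BijectiveOn (𝓓 r v 𝐰) (𝓐 k r f (𝐱 ++ 𝐰)) (map just 𝐱 ++_))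
    × BijectiveOn (DeoMax f v 𝐰) (AffineDeoMax k f (𝐱 ++ 𝐰)) (map just 𝐱 ++_)
    × P k w ᵁ ≡ image k w
    × (_∈ image k w) ≐ I₁ f
corollary3p12 n k 2≤n k≤n v w v∈ w∈ v≤w w-grass 𝐱 𝐰 𝐱-reduced 𝐰-reduced =
    (x∙v∈S̃ {k} {v} {w} k≤n v∈ w∈ , x∙v-bounded {k} {w} w∈ w-grass {v} v∈ v≤w)
  , subst (λ S → IsReducedWord k (τ S) (𝐱 ++ 𝐰)) (sym up-steps) (concatenation-reduced {k} {w} w∈ w-grass 𝐱 𝐰 𝐱-reduced 𝐰-reduced)
  , bijective
  -- Both maximal sets are the case r = r₀(f), and prepending preserves the number of entries e.
  , bijective (r₀ (x k w ∙ v))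
  , up-steps
  , image≐I₁ {k} {w} w∈ w-grass {v} v∈
  where
  open Affine n 2≤n
  open Lemmas n 2≤n
  up-steps : P k w ᵁ ≡ image k w
  up-steps = path-up-steps (image k w)
  bijective : ∀ r → BijectiveOn (𝓓 r v 𝐰) (𝓐 k r (x k w ∙ v) (𝐱 ++ 𝐰)) (map just 𝐱 ++_)
  bijective = prepend-bijective {x k w} {v} {k} {𝐱} {𝐰} (x-minimal {k} {w} w∈ w-grass) v∈ 𝐱-reduced (proj₁ 𝐰-reduced)
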